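{- Let $\alpha\in[0,1)$, let $G\in\mathcal{G}_n^m$ with strong component $G^*$ and hanging trees $T^{(1)},\dots,T^{(m)}$ ($|\mathcal{V}(T^{(i)})|=n_i$), and let $G'$ be the digraph obtained from $G$ by replacing, for each $i$, the arcs of $T^{(i)}$ by the arcs $(v_i,u)$ for all $u\in\mathcal{V}(T^{(i)})\setminus\{v_i\}$ (so each $T^{(i)}$ becomes an out-star on the same vertex set centred at $v_i$). Then $\rho_\alpha(G')\ge\rho_\alpha(G)$.
   Context: All digraphs are finite, without loops or multiple arcs. $A(G)$ is the adjacency matrix, $D^+(G)$ the diagonal matrix of outdegrees, $A_\alpha(G)=\alpha D^+(G)+(1-\alpha)A(G)$, and $\rho_\alpha(G)$ is the spectral radius (largest modulus of an eigenvalue) of $A_\alpha(G)$. A directed tree is a digraph whose underlying graph is a tree (a single vertex allowed). The class $\mathcal{G}_n^m$ ($2\le m\le n$): $G\in\mathcal{G}_n^m$ consists of a strongly connected digraph $G^*$ on $m$ vertices $v_1,\dots,v_m$ together with directed trees $T^{(1)},\dots,T^{(m)}$, where $T^{(i)}$ has $n_i\ge1$ vertices including $v_i$, the sets $\mathcal{V}(T^{(i)})$ are pairwise disjoint, $\mathcal{V}(T^{(i)})\cap\mathcal{V}(G^*)=\{v_i\}$, $n=\sum_i n_i$, and the arcs of $G$ are those of $G^*$ and of the $T^{(i)}$. The vertices of $G^*$ are labeled so that $d_{G^*}^+(v_1)\ge d_{G^*}^+(v_2)\ge\cdots\ge d_{G^*}^+(v_m)$. -}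

module Defs where

open import Algebra.Bundles using (CommutativeRing; RawMonoid)
import Algebra.Definitions.RawMonoid as RawMonoidDefinitions
open import Data.Bool.Base using (if_then_else_)
open import Data.Fin.Base as Fin using (Fin; zero; suc; inject₁; fromℕ)
open import Data.Fin.Properties using (_≟_)
open import Data.Nat.Base as ℕ using (ℕ)
open import Data.Product using (Σ; ∃; ∃-syntax; _×_; _,_)
open import Data.Vec.Base using (count; allFin)
open import Data.Vec.Functional using (Vector)
open import Function.Base using (_∘_)
open import Function.Bundles using (_↔_; module Inverse)
open import Function.Definitions using (Injective)
open import Level using (0ℓ)
open import Relation.Binary.Core using (Rel)
open import Relation.Binary.Definitions using (Decidable; Irreflexive; Asymmetric)
open import Relation.Binary.Construct.Closure.ReflexiveTransitive using (Star)
open import Relation.Binary.Construct.Closure.Symmetric using (SymClosure)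
open import Relation.Binary.PropositionalEquality using (_≡_; _≢_; refl)
open import Relation.Binary.Structures using (IsDecTotalOrder)
open import Relation.Nullary.Decidable using (yes; no; does; _×-dec_; ¬?)
open import Relation.Nullary.Negation using (¬_)
open import Relation.Unary using (Pred)

-- ℝ, up to isomorphism: a Dedekind-complete ordered field.  Equality and
-- order are decidable, as they are for the classical reals.
record CompleteOrderedField : Set₁ where
  infix 4 _≤_ _<_
  field
    commutativeRing : CommutativeRing 0ℓ 0ℓ

  open CommutativeRing commutativeRing public

  field
    _≤_             : Rel Carrier 0ℓ
    isDecTotalOrder : IsDecTotalOrder _≈_ _≤_
    0≉1             : ¬ 0# ≈ 1#
    inverse         : ∀ x → ¬ x ≈ 0# → ∃[ y ] x * y ≈ 1#
    +-monoˡ-≤       : ∀ z {x y} → x ≤ y → x + z ≤ y + z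
    *-nonNegative   : ∀ {x y} → 0# ≤ x → 0# ≤ y → 0# ≤ x * y

  _<_ : Rel Carrier 0ℓ
  x < y = x ≤ y × ¬ x ≈ y

  IsUpperBound : Pred Carrier 0ℓ → Pred Carrier 0ℓ
  IsUpperBound S b = ∀ {x} → S x → x ≤ b

  field
    supremum : (S : Pred Carrier 0ℓ) → ∃ S → ∃ (IsUpperBound S) →
               ∃[ s ] IsUpperBound S s × (∀ {b} → IsUpperBound S b → s ≤ b)

module Complex (ℝ : CompleteOrderedField) where
  open CompleteOrderedField ℝ

  infix  4 _≈ᶜ_
  infixl 6 _+ᶜ_
  infixl 7 _*ᶜ_

  record ℂ : Set where
    constructor _+i_
    field
      re im : Carrier

  open ℂ public

  _≈ᶜ_ : Rel ℂ 0ℓ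
  w ≈ᶜ z = re w ≈ re z × im w ≈ im z

  fromReal : Carrier → ℂ
  fromReal x = x +i 0#

  0ᶜ : ℂ
  0ᶜ = fromReal 0#

  _+ᶜ_ : ℂ → ℂ → ℂ
  w +ᶜ z = (re w + re z) +i (im w + im z)

  _*ᶜ_ : ℂ → ℂ → ℂ
  w *ᶜ z = (re w * re z - im w * im z) +i (re w * im z + im w * re z)

  +ᶜ-rawMonoid : RawMonoid 0ℓ 0ℓ
  +ᶜ-rawMonoid = record { Carrier = ℂ ; _≈_ = _≈ᶜ_ ; _∙_ = _+ᶜ_ ; ε = 0ᶜ }

  open RawMonoidDefinitions +ᶜ-rawMonoid public using () renaming (sum to sumᶜ)

  -- r = ∣ z ∣
  IsModulus : ℂ → Carrier → Set
  IsModulus z r = 0# ≤ r × r * r ≈ re z * re z + im z * im z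

Matrix : Set → ℕ → Set
Matrix A n = Fin n → Fin n → A

module Spectrum (ℝ : CompleteOrderedField) where
  open CompleteOrderedField ℝ
  open Complex ℝ

  IsEigenvalue : ∀ {n} → Matrix Carrier n → ℂ → Set
  IsEigenvalue {n} M μ = Σ (Vector ℂ n) λ z →
    ¬ (∀ i → z i ≈ᶜ 0ᶜ) ×
    (∀ i → sumᶜ (λ j → fromReal (M i j) *ᶜ z j) ≈ᶜ μ *ᶜ z i)

  IsSpectralRadius : ∀ {n} → Matrix Carrier n → Carrier → Set
  IsSpectralRadius M ρ =
    (∃[ μ ] IsEigenvalue M μ × IsModulus μ ρ) ×
    (∀ μ r → IsEigenvalue M μ → IsModulus μ r → r ≤ ρ)

record Digraph (n : ℕ) : Set₁ where
  infix 4 _⟶_ _⟶?_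
  field
    _⟶_      : Rel (Fin n) 0ℓ
    _⟶?_     : Decidable _⟶_
    loopless : Irreflexive _≡_ _⟶_

  outdegree : Fin n → ℕ
  outdegree u = count (u ⟶?_) (allFin n)

  StronglyConnected : Set
  StronglyConnected = ∀ u w → Star _⟶_ u w

  Edge : Rel (Fin n) 0ℓ
  Edge = SymClosure _⟶_

  Connected : Set
  Connected = ∀ u w → Star Edge u w

  record Cycle : Set where
    field
      {k}      : ℕ
      vertex   : Fin (3 ℕ.+ k) → Fin n
      distinct : Injective _≡_ _≡_ vertex
      step     : ∀ i → Edge (vertex (inject₁ i)) (vertex (suc i))
      close    : Edge (vertex (fromℕ (2 ℕ.+ k))) (vertex zero)

  -- Asymmetry: a pair of opposite arcs would be a double edge (a cycle of
  -- length 2) of the underlying graph, so a directed tree has none.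
  record IsDirectedTree : Set where
    field
      asymmetric : Asymmetric _⟶_
      connected  : Connected
      acyclic    : ¬ Cycle

outStar : ∀ {n} → Fin n → Digraph n
outStar c = record
  { _⟶_      = λ u w → u ≡ c × w ≢ c
  ; _⟶?_     = λ u w → (u ≟ c) ×-dec ¬? (w ≟ c)
  ; loopless = λ { refl (u≡c , u≢c) → u≢c u≡c }
  }

module _ {m : ℕ} {size : Fin m → ℕ}
         (G* : Digraph m)
         (T : ∀ i → Digraph (size i))
         (root : ∀ i → Fin (size i)) where

  private
    module G* = Digraph G*
    module T i = Digraph (T i)

    V : Set
    V = Σ (Fin m) (Fin ∘ size)

  -- Arcs after identifying each vertex i of G* with the root of T i.
  data HangArc : Rel V 0ℓ where
    core : ∀ {i j} → i G*.⟶ j → HangArc (i , root i) (j , root j)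
    tree : ∀ {i a b} → T._⟶_ i a b → HangArc (i , a) (i , b)

  private
    hangArc-irrefl : ∀ {p} → ¬ HangArc p p
    hangArc-irrefl (core e) = G*.loopless refl e
    hangArc-irrefl (tree e) = T.loopless _ refl e

    IsCore : Rel V 0ℓ
    IsCore (i , a) (j , b) = (a ≡ root i × b ≡ root j) × i G*.⟶ j

    isCore? : Decidable IsCore
    isCore? (i , a) (j , b) = ((a ≟ root i) ×-dec (b ≟ root j)) ×-dec (i G*.⟶? j)

    fromCore : ∀ {p q} → IsCore p q → HangArc p q
    fromCore ((refl , refl) , e) = core e

    hangArc? : Decidable HangArc
    hangArc? p@(i , a) q@(j , b) with isCore? p q
    ... | yes c = yes (fromCore c)
    ... | no ¬c with i ≟ j
    ...   | no i≢j = no λ { (core e) → ¬c ((refl , refl) , e)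
                          ; (tree e) → i≢j refl }
    ...   | yes refl with T._⟶?_ i a b
    ...     | yes e = yes (tree e)
    ...     | no ¬e = no λ { (core e) → ¬c ((refl , refl) , e)
                           ; (tree e) → ¬e e }

  hang : ∀ {n} → Fin n ↔ V → Digraph n
  hang vertices = record
    { _⟶_      = λ u w → HangArc (to u) (to w)
    ; _⟶?_     = λ u w → hangArc? (to u) (to w)
    ; loopless = λ { refl → hangArc-irrefl }
    }
    where open Inverse vertices

-- The vertex v_i is (i , root i).  The bijection `vertices` says that the
-- vertex set is the disjoint union of those of the trees; in particular
-- n is the sum of the `size i`, and `root` forces size i ≥ 1.
record 𝒢 (n m : ℕ) : Set₁ where
  field
    2≤m               : 2 ℕ.≤ m
    m≤n               : m ℕ.≤ n
    G*                : Digraph m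
    stronglyConnected : Digraph.StronglyConnected G*
    outdegree-sorted  : ∀ {i j} → i Fin.≤ j →
                        Digraph.outdegree G* j ℕ.≤ Digraph.outdegree G* i
    size              : Fin m → ℕ
    T                 : ∀ i → Digraph (size i)
    isDirectedTree    : ∀ i → Digraph.IsDirectedTree (T i)
    root              : ∀ i → Fin (size i)
    vertices          : Fin n ↔ Σ (Fin m) (Fin ∘ size)

  digraph : Digraph n
  digraph = hang G* T root vertices

  starDigraph : Digraph n
  starDigraph = hang G* (λ i → outStar (root i)) root vertices

module DigraphMatrices (ℝ : CompleteOrderedField) {n : ℕ} (G : Digraph n) where
  open CompleteOrderedField ℝ
  open Digraph G
  open RawMonoidDefinitions +-rawMonoid using () renaming (_×_ to _·_)

  A : Matrix Carrier n
  A u w = if does (u ⟶? w) then 1# else 0#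

  D⁺ : Matrix Carrier n
  D⁺ u w = if does (u ≟ w) then outdegree u · 1# else 0#

  Aα : Carrier → Matrix Carrier n
  Aα α u w = α * D⁺ u w + (1# - α) * A u w

{-# OPTIONS --safe #-}

-- A nonnegative matrix M with a subinvariant vector x (x ≥ 0, x ≠ 0, M x ≥ r x)
-- has spectral radius at least r: the supremum t of all such r is an eigenvalue,
-- for otherwise (t - M) y = 1 is solvable, y must be positive, and y then shows
-- that a number below t still bounds every such r.
--
-- The moduli x of an eigenvector of A_α(G) for an eigenvalue of modulus ρ satisfy
-- A_α(G) x ≥ ρ x.  Suppose ρ′ < ρ.  For u in T⁽ⁱ⁾ the degree of u in G is at most
-- that of v_i in G′, and α times the latter is at most ρ′; hence each non-root
-- vertex in the support of x has an out-neighbour in the support.  The trees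
-- contain no infinite directed walk, so x vanishes on the tree out-neighbours of
-- every root but not on all roots, and the restriction of x to the roots is
-- subinvariant for A_α(G′) and ρ.

module Submission where

import Algebra.Definitions.RawMonoid as RawMonoidDefinitions
import Algebra.Properties.AbelianGroup as AbelianGroupProperties
import Algebra.Properties.Ring as RingProperties
import Algebra.Properties.Semiring.Mult.TCOptimised as Multiples
import Algebra.Properties.Semiring.Sum as SemiringSum
import Algebra.Solver.Ring as RingSolver
open import Algebra.Bundles using (CommutativeRing)
open import Algebra.Solver.Ring.AlmostCommutativeRing using (fromCommutativeRing; _-Raw-AlmostCommutative⟶_)
open import Data.Bool.Base using (if_then_else_; true; false)
open import Data.Empty using (⊥; ⊥-elim)
open import Data.Fin.Base using (Fin; zero; suc; toℕ; punchIn; punchOut)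
open import Data.Fin.Permutation using (transpose)
import Data.Fin.Permutation.Components as PC
open import Data.Fin.Properties as Fin using (all?; any?; ¬∀⟶∃¬; punchInᵢ≢i; punchIn-punchOut; pigeonhole; toℕ-injective; toℕ-inject₁; toℕ-fromℕ; toℕ<n)
import Data.Integer.Base as ℤ
import Data.Integer.Properties as ℤₚ
open import Data.Maybe.Base using (Maybe; map)
open import Data.Nat.Base as ℕ using (ℕ; zero; suc)
open import Data.Nat.Induction using (<-rec)
import Data.Nat.Properties as ℕₚ
open import Data.Product using (Σ; ∃; ∃-syntax; _×_; _,_; proj₁; proj₂)
open import Data.Sum.Base using (_⊎_; inj₁; inj₂)
open import Data.Vec.Base using (count; tabulate)
open import Data.Vec.Functional using (Vector)
open import Function.Base using (_∘_; id)
open import Function.Bundles using (module Inverse)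
open import Level using (0ℓ)
open import Relation.Binary.Bundles using (Poset)
open import Relation.Binary.Consequences using (dec⇒weaklyDec)
open import Relation.Binary.Construct.Closure.Symmetric using (fwd)
open import Relation.Binary.Definitions using (Asymmetric; tri<; tri≈; tri>)
open import Relation.Binary.PropositionalEquality as ≡ using (_≡_; _≢_)
import Relation.Binary.Reasoning.PartialOrder as PartialOrderReasoning
import Relation.Binary.Reasoning.Setoid as SetoidReasoning
open import Relation.Binary.Structures using (IsDecTotalOrder)
open import Relation.Nullary.Decidable using (Dec; yes; no; does; dec-true; dec-false; decidable-stable; _×-dec_; ¬?)
open import Relation.Nullary.Negation using (¬_; contradiction)
open import Relation.Unary using (Decidable)

open import Defs

-- The ring solver with integer coefficients.

module IntegerCoefficients (R : CommutativeRing 0ℓ 0ℓ) where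
  open CommutativeRing R
  open RingProperties ring
  open AbelianGroupProperties +-abelianGroup using (⁻¹-∙-comm; ⁻¹-involutive; ε⁻¹≈ε)
  open Multiples semiring renaming (_×_ to _·_)
  open ℤ using (ℤ; +_; -[1+_]; _⊖_)
  open SetoidReasoning setoid

  -- Integer coefficients have decidable equality, which lets the solver discard vanishing terms.
  -- With the optimised multiples `⟦ + 1 ⟧` reduces to `1#`.
  ⟦_⟧ : ℤ → Carrier
  ⟦ + n ⟧      = n · 1#
  ⟦ -[1+ n ] ⟧ = - (suc n · 1#)

  ⟦-⟧ : ∀ i → ⟦ ℤ.- i ⟧ ≈ - ⟦ i ⟧
  ⟦-⟧ (+ zero)   = sym ε⁻¹≈ε
  ⟦-⟧ (+ suc n)  = refl
  ⟦-⟧ -[1+ n ]   = sym (⁻¹-involutive _)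

  ⟦⊖⟧ : ∀ m n → ⟦ m ⊖ n ⟧ ≈ m · 1# - n · 1#
  ⟦⊖⟧ m zero = begin
    m · 1#         ≈⟨ +-identityʳ _ ⟨
    m · 1# + 0#    ≈⟨ +-congˡ ε⁻¹≈ε ⟨
    m · 1# + - 0#  ∎
  ⟦⊖⟧ zero (suc n) = sym (+-identityˡ _)
  ⟦⊖⟧ (suc m) (suc n) = begin
    ⟦ suc m ⊖ suc n ⟧                    ≡⟨ ≡.cong ⟦_⟧ (ℤₚ.[1+m]⊖[1+n]≡m⊖n m n) ⟩
    ⟦ m ⊖ n ⟧                            ≈⟨ ⟦⊖⟧ m n ⟩
    x - y                                ≈⟨ +-congʳ (+-identityʳ x) ⟨
    (x + 0#) - y                         ≈⟨ +-congʳ (+-congˡ (-‿inverseʳ 1#)) ⟨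
    (x + (1# - 1#)) - y                  ≈⟨ +-congʳ (+-assoc x 1# (- 1#)) ⟨
    ((x + 1#) - 1#) - y                  ≈⟨ +-assoc _ _ _ ⟩
    (x + 1#) + (- 1# - y)                ≈⟨ +-congˡ (+-comm _ _) ⟩
    (x + 1#) + (- y - 1#)                ≈⟨ +-congˡ (⁻¹-∙-comm y 1#) ⟩
    -- `suc m · 1#` is stuck for a variable `m`, so it is reached by way of `m + 1`.
    (x + 1#) - (y + 1#)                  ≈⟨ +-cong (×-homo-+ 1# m 1) (-‿cong (×-homo-+ 1# n 1)) ⟨
    (m ℕ.+ 1) · 1# - (n ℕ.+ 1) · 1#      ≡⟨ ≡.cong₂ (λ a b → a · 1# - b · 1#) (ℕₚ.+-comm m 1) (ℕₚ.+-comm n 1) ⟩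
    suc m · 1# - suc n · 1#              ∎
    where
    x = m · 1#
    y = n · 1#

  ⟦+⟧ : ∀ i j → ⟦ i ℤ.+ j ⟧ ≈ ⟦ i ⟧ + ⟦ j ⟧
  ⟦+⟧ (+ m)    (+ n)    = ×-homo-+ 1# m n
  ⟦+⟧ (+ m)    -[1+ n ] = ⟦⊖⟧ m (suc n)
  ⟦+⟧ -[1+ m ] (+ n)    = trans (⟦⊖⟧ n (suc m)) (+-comm _ _)
  ⟦+⟧ -[1+ m ] -[1+ n ] = begin
    - (suc (suc (m ℕ.+ n)) · 1#)     ≡⟨ ≡.cong (λ a → - (a · 1#)) (ℕₚ.+-suc (suc m) n) ⟨
    - ((suc m ℕ.+ suc n) · 1#)       ≈⟨ -‿cong (×-homo-+ 1# (suc m) (suc n)) ⟩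
    - (suc m · 1# + suc n · 1#)      ≈⟨ ⁻¹-∙-comm _ _ ⟨
    - (suc m · 1#) - (suc n · 1#)    ∎

  ⟦*⟧⁺ : ∀ m n → ⟦ + m ℤ.* + n ⟧ ≈ (m · 1#) * (n · 1#)
  ⟦*⟧⁺ m n = begin
    ⟦ + m ℤ.* + n ⟧      ≡⟨ ≡.cong ⟦_⟧ (ℤₚ.pos-* m n) ⟨
    (m ℕ.* n) · 1#       ≈⟨ ×1-homo-* m n ⟩
    (m · 1#) * (n · 1#)  ∎

  ⟦*⟧ : ∀ i j → ⟦ i ℤ.* j ⟧ ≈ ⟦ i ⟧ * ⟦ j ⟧
  ⟦*⟧ (+ m)    (+ n)    = ⟦*⟧⁺ m n
  ⟦*⟧ (+ m)    -[1+ n ] = begin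
    ⟦ + m ℤ.* -[1+ n ] ⟧          ≡⟨ ≡.cong ⟦_⟧ (ℤₚ.neg-distribʳ-* (+ m) (+ suc n)) ⟨
    ⟦ ℤ.- (+ m ℤ.* + suc n) ⟧     ≈⟨ ⟦-⟧ (+ m ℤ.* + suc n) ⟩
    - ⟦ + m ℤ.* + suc n ⟧         ≈⟨ -‿cong (⟦*⟧⁺ m (suc n)) ⟩
    - (m · 1# * (suc n · 1#))     ≈⟨ -‿distribʳ-* _ _ ⟩
    m · 1# * - (suc n · 1#)       ∎
  ⟦*⟧ -[1+ m ] (+ n)    = begin
    ⟦ -[1+ m ] ℤ.* + n ⟧          ≡⟨ ≡.cong ⟦_⟧ (ℤₚ.neg-distribˡ-* (+ suc m) (+ n)) ⟨
    ⟦ ℤ.- (+ suc m ℤ.* + n) ⟧     ≈⟨ ⟦-⟧ (+ suc m ℤ.* + n) ⟩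
    - ⟦ + suc m ℤ.* + n ⟧         ≈⟨ -‿cong (⟦*⟧⁺ (suc m) n) ⟩
    - (suc m · 1# * (n · 1#))     ≈⟨ -‿distribˡ-* _ _ ⟩
    - (suc m · 1#) * (n · 1#)     ∎
  ⟦*⟧ -[1+ m ] -[1+ n ] = begin
    ⟦ + suc m ℤ.* + suc n ⟧            ≈⟨ ⟦*⟧⁺ (suc m) (suc n) ⟩
    suc m · 1# * (suc n · 1#)          ≈⟨ ⁻¹-involutive _ ⟨
    - - (suc m · 1# * (suc n · 1#))    ≈⟨ -‿cong (-‿distribˡ-* _ _) ⟩
    - (- (suc m · 1#) * (suc n · 1#))  ≈⟨ -‿distribʳ-* _ _ ⟩
    - (suc m · 1#) * - (suc n · 1#)    ∎

  homomorphism : CommutativeRing.rawRing ℤₚ.+-*-commutativeRing -Raw-AlmostCommutative⟶ fromCommutativeRing R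
  homomorphism = record
    { ⟦_⟧    = ⟦_⟧
    ; +-homo = ⟦+⟧
    ; *-homo = ⟦*⟧
    ; -‿homo = ⟦-⟧
    ; 0-homo = refl
    ; 1-homo = refl
    }

  _≟ᶜ_ : ∀ i j → Maybe (⟦ i ⟧ ≈ ⟦ j ⟧)
  i ≟ᶜ j = map (λ { ≡.refl → refl }) (dec⇒weaklyDec ℤₚ._≟_ i j)

  open RingSolver _ _ homomorphism _≟ᶜ_ public
    using (Polynomial; con; solve; _:=_; _:+_; _:*_; :-_; _:-_)

  :0 :1 : ∀ {n} → Polynomial n
  :0 = con (+ 0)
  :1 = con (+ 1)

-- Arithmetic in an ordered field.

module OrderedField (ℝ : CompleteOrderedField) where
  open CompleteOrderedField ℝ hiding (zero)
  open IsDecTotalOrder isDecTotalOrder public using (_≟_; _≤?_; total; antisym)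
    renaming (refl to ≤-refl; trans to ≤-trans; reflexive to ≤-reflexive)
  open IntegerCoefficients commutativeRing
  open SemiringSum semiring public

  poset : Poset _ _ _
  poset = record { isPartialOrder = IsDecTotalOrder.isPartialOrder isDecTotalOrder }

  open PartialOrderReasoning poset

  x≤y⇒0≤y-x : ∀ {x y} → x ≤ y → 0# ≤ y - x
  x≤y⇒0≤y-x {x} {y} x≤y = begin
    0#     ≈⟨ -‿inverseʳ x ⟨
    x - x  ≤⟨ +-monoˡ-≤ (- x) x≤y ⟩
    y - x  ∎

  0≤y-x⇒x≤y : ∀ {x y} → 0# ≤ y - x → x ≤ y
  0≤y-x⇒x≤y {x} {y} 0≤y-x = begin
    x            ≈⟨ +-identityˡ x ⟨
    0# + x       ≤⟨ +-monoˡ-≤ x 0≤y-x ⟩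
    (y - x) + x  ≈⟨ solve 2 (λ y x → (y :- x) :+ x := y) refl y x ⟩
    y            ∎

  +-mono-≤ : ∀ {x y u v} → x ≤ y → u ≤ v → x + u ≤ y + v
  +-mono-≤ {x} {y} {u} {v} x≤y u≤v = begin
    x + u  ≤⟨ +-monoˡ-≤ u x≤y ⟩
    y + u  ≈⟨ +-comm y u ⟩
    u + y  ≤⟨ +-monoˡ-≤ y u≤v ⟩
    v + y  ≈⟨ +-comm v y ⟩
    y + v  ∎

  +-nonNegative : ∀ {x y} → 0# ≤ x → 0# ≤ y → 0# ≤ x + y
  +-nonNegative {x} {y} 0≤x 0≤y = begin
    0#       ≈⟨ +-identityˡ 0# ⟨
    0# + 0#  ≤⟨ +-mono-≤ 0≤x 0≤y ⟩
    x + y    ∎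

  *-monoʳ-≤ : ∀ {x y z} → 0# ≤ z → x ≤ y → z * x ≤ z * y
  *-monoʳ-≤ {x} {y} {z} 0≤z x≤y = 0≤y-x⇒x≤y (begin
    0#             ≤⟨ *-nonNegative 0≤z (x≤y⇒0≤y-x x≤y) ⟩
    z * (y - x)    ≈⟨ solve 3 (λ x y z → z :* (y :- x) := z :* y :- z :* x) refl x y z ⟩
    z * y - z * x  ∎)

  *-monoˡ-≤ : ∀ {x y z} → 0# ≤ z → x ≤ y → x * z ≤ y * z
  *-monoˡ-≤ {x} {y} {z} 0≤z x≤y = begin
    x * z  ≈⟨ *-comm x z ⟩
    z * x  ≤⟨ *-monoʳ-≤ 0≤z x≤y ⟩
    z * y  ≈⟨ *-comm z y ⟩
    y * z  ∎

  ≰⇒≥ : ∀ {x y} → ¬ x ≤ y → y ≤ x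
  ≰⇒≥ {x} {y} x≰y with total x y
  ... | inj₁ x≤y = contradiction x≤y x≰y
  ... | inj₂ y≤x = y≤x

  ≰⇒> : ∀ {x y} → ¬ x ≤ y → y < x
  ≰⇒> x≰y = ≰⇒≥ x≰y , λ y≈x → x≰y (≤-reflexive (sym y≈x))

  <⇒≱ : ∀ {x y} → x < y → ¬ y ≤ x
  <⇒≱ (x≤y , x≉y) y≤x = x≉y (antisym x≤y y≤x)

  neg-nonNegative : ∀ {x} → x ≤ 0# → 0# ≤ - x
  neg-nonNegative {x} x≤0 = begin
    0#      ≤⟨ x≤y⇒0≤y-x x≤0 ⟩
    0# - x  ≈⟨ +-identityˡ (- x) ⟩
    - x     ∎

  square-nonNegative : ∀ x → 0# ≤ x * x
  square-nonNegative x with total 0# x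
  ... | inj₁ 0≤x = *-nonNegative 0≤x 0≤x
  ... | inj₂ x≤0 = begin
    0#         ≤⟨ *-nonNegative (neg-nonNegative x≤0) (neg-nonNegative x≤0) ⟩
    - x * - x  ≈⟨ solve 1 (λ x → :- x :* :- x := x :* x) refl x ⟩
    x * x      ∎

  0≤1 : 0# ≤ 1#
  0≤1 = ≤-trans (square-nonNegative 1#) (≤-reflexive (*-identityˡ 1#))

  0<1 : 0# < 1#
  0<1 = 0≤1 , 0≉1

  1≰0 : ¬ 1# ≤ 0#
  1≰0 = <⇒≱ 0<1

  positive-inverse : ∀ {x} → 0# < x → ∃[ y ] 0# < y × x * y ≈ 1#
  positive-inverse {x} (0≤x , 0≉x) with inverse x (0≉x ∘ sym)
  ... | y , xy≈1 = y , ≰⇒> y≰0 , xy≈1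
    where
    y≰0 : ¬ y ≤ 0#
    y≰0 y≤0 = 1≰0 (begin
      1#      ≈⟨ xy≈1 ⟨
      x * y   ≤⟨ *-monoʳ-≤ 0≤x y≤0 ⟩
      x * 0#  ≈⟨ zeroʳ x ⟩
      0#      ∎)

  *-cancelʳ-≤ : ∀ {x y z} → 0# < z → x * z ≤ y * z → x ≤ y
  *-cancelʳ-≤ {x} {y} {z} 0<z xz≤yz =
    let w , (0≤w , _) , zw≈1 = positive-inverse 0<z in begin
    x            ≈⟨ *-identityʳ x ⟨
    x * 1#       ≈⟨ *-congˡ zw≈1 ⟨
    x * (z * w)  ≈⟨ *-assoc x z w ⟨
    (x * z) * w  ≤⟨ *-monoˡ-≤ 0≤w xz≤yz ⟩
    (y * z) * w  ≈⟨ *-assoc y z w ⟩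
    y * (z * w)  ≈⟨ *-congˡ zw≈1 ⟩
    y * 1#       ≈⟨ *-identityʳ y ⟩
    y            ∎

  *-positive : ∀ {x y} → 0# < x → 0# < y → 0# < x * y
  *-positive {x} {y} 0<x 0<y = ≰⇒> λ xy≤0 →
    <⇒≱ 0<x (*-cancelʳ-≤ 0<y (≤-trans xy≤0 (≤-reflexive (sym (zeroˡ y)))))

  -- Nonnegative vectors and finite sums.

  NonNegative : ∀ {n} → Vector Carrier n → Set
  NonNegative x = ∀ i → 0# ≤ x i

  NonZero : ∀ {n} → Vector Carrier n → Set
  NonZero x = ¬ (∀ i → x i ≈ 0#)

  nonZero⇒∃ : ∀ {n} {x : Vector Carrier n} → NonZero x → ∃[ i ] ¬ x i ≈ 0#
  nonZero⇒∃ {x = x} = ¬∀⟶∃¬ _ _ (λ i → x i ≟ 0#)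

  sum-zero : ∀ {n} {x : Vector Carrier n} → (∀ i → x i ≈ 0#) → sum x ≈ 0#
  sum-zero {n} x≈0 = trans (sum-cong-≋ x≈0) (sum-replicate-zero n)

  sum-mono-≤ : ∀ {n} {x y : Vector Carrier n} → (∀ i → x i ≤ y i) → sum x ≤ sum y
  sum-mono-≤ {zero}  x≤y = ≤-refl
  sum-mono-≤ {suc n} x≤y = +-mono-≤ (x≤y zero) (sum-mono-≤ (x≤y ∘ suc))

  sum-nonNegative : ∀ {n} {x : Vector Carrier n} → NonNegative x → 0# ≤ sum x
  sum-nonNegative {n} 0≤x = ≤-trans (≤-reflexive (sym (sum-zero {n} (λ _ → refl)))) (sum-mono-≤ 0≤x)

  entry≤sum : ∀ {n} {x : Vector Carrier n} → NonNegative x → ∀ i → x i ≤ sum x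
  entry≤sum {suc n} {x} 0≤x i = begin
    x i                         ≈⟨ +-identityʳ (x i) ⟨
    x i + 0#                    ≤⟨ +-mono-≤ ≤-refl (sum-nonNegative (0≤x ∘ punchIn i)) ⟩
    x i + sum (x ∘ punchIn i)   ≈⟨ sum-remove {i = i} x ⟨
    sum x                       ∎

  sum-single : ∀ {n} (x : Vector Carrier n) i → (∀ j → j ≢ i → x j ≈ 0#) → sum x ≈ x i
  sum-single {suc n} x i x≈0 = begin-equality
    sum x                       ≈⟨ sum-remove {i = i} x ⟩
    x i + sum (x ∘ punchIn i)   ≈⟨ +-congˡ (sum-zero (λ j → x≈0 (punchIn i j) (punchInᵢ≢i i j))) ⟩
    x i + 0#                    ≈⟨ +-identityʳ (x i) ⟩
    x i                         ∎

  maximal : ∀ {n} (x : Vector Carrier (suc n)) → ∃[ i ] ∀ j → x j ≤ x i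
  maximal {zero} x = zero , λ { zero → ≤-refl }
  maximal {suc n} x with maximal (x ∘ suc)
  ... | i , max with total (x zero) (x (suc i))
  ...   | inj₁ x₀≤ = suc i , λ { zero → x₀≤ ; (suc j) → max j }
  ...   | inj₂ ≤x₀ = zero , λ { zero → ≤-refl ; (suc j) → ≤-trans (max j) ≤x₀ }

  -- The inverse of `1# + sum y` serves as ε: the sum dominates every entry, and the added 1 keeps
  -- the denominator positive even when `y` vanishes.
  small-multiple : ∀ {n} {y : Vector Carrier n} → NonNegative y → ∃[ ε ] 0# < ε × (∀ i → ε * y i ≤ 1#)
  small-multiple {y = y} 0≤y = ε , 0<ε , λ i → begin
    ε * y i           ≤⟨ *-monoʳ-≤ 0≤ε (entry≤sum 0≤y i) ⟩
    ε * sum y         ≈⟨ +-identityˡ (ε * sum y) ⟨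
    0# + ε * sum y    ≤⟨ +-mono-≤ 0≤ε ≤-refl ⟩
    ε + ε * sum y     ≈⟨ solve 2 (λ s e → e :+ e :* s := (:1 :+ s) :* e) refl (sum y) ε ⟩
    (1# + sum y) * ε  ≈⟨ bε≈1 ⟩
    1#                ∎
    where
    0<b : 0# < 1# + sum y
    0<b = ≰⇒> λ b≤0 → 1≰0 (begin
      1#          ≈⟨ +-identityʳ 1# ⟨
      1# + 0#     ≤⟨ +-mono-≤ ≤-refl (sum-nonNegative 0≤y) ⟩
      1# + sum y  ≤⟨ b≤0 ⟩
      0#          ∎)
    ε = proj₁ (positive-inverse 0<b)
    0<ε = proj₁ (proj₂ (positive-inverse 0<b))
    0≤ε = proj₁ 0<ε
    bε≈1 = proj₂ (proj₂ (positive-inverse 0<b))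

  -- Matrix-vector products and linear systems.

  infixr 7 _∙_
  _∙_ : ∀ {n} → Matrix Carrier n → Vector Carrier n → Vector Carrier n
  (M ∙ x) i = sum λ j → M i j * x j

  -- Elimination rows, the rows of t - M and those of `Aα` are all combinations of two rows; this
  -- identity evaluates each of them on a vector.
  sum-linear : ∀ {n} c d (u v w : Vector Carrier n) →
               sum (λ j → (c * u j + d * v j) * w j) ≈ c * sum (λ j → u j * w j) + d * sum (λ j → v j * w j)
  sum-linear {zero}  c d u v w = solve 2 (λ c d → :0 := c :* :0 :+ d :* :0) refl c d
  sum-linear {suc n} c d u v w = trans (+-congˡ (sum-linear c d (u ∘ suc) (v ∘ suc) (w ∘ suc)))
    (solve 7 (λ c d u v w s t → (c :* u :+ d :* v) :* w :+ (c :* s :+ d :* t)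
                                := c :* (u :* w :+ s) :+ d :* (v :* w :+ t))
           refl c d (u zero) (v zero) (w zero) _ _)

  -- Gaussian elimination: a nonzero entry of the first column serves as pivot.
  kernel : ∀ n (a : Fin n → Fin (suc n) → Carrier) →
           ∃[ w ] NonZero w × (∀ i → sum (λ j → a i j * w j) ≈ 0#)
  kernel zero    a = (λ _ → 1#) , (λ 1≈0 → 0≉1 (sym (1≈0 zero))) , λ ()
  kernel (suc n) a with all? (λ i → a i zero ≟ 0#)
  -- A zero first column leaves the first unknown free, so the first unit vector is a solution.
  ... | yes col≈0 = w , (λ w≈0 → 0≉1 (sym (w≈0 zero))) , λ i → begin-equality
      a i zero * 1# + sum (λ j → a i (suc j) * 0#)  ≈⟨ +-cong (*-identityʳ _) (sum-zero λ j → zeroʳ (a i (suc j))) ⟩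
      a i zero + 0#                                 ≈⟨ +-identityʳ _ ⟩
      a i zero                                      ≈⟨ col≈0 i ⟩
      0#                                            ∎
    where
    w : Vector Carrier (suc (suc n))
    w zero    = 1#
    w (suc _) = 0#
  ... | no col≉0 with ¬∀⟶∃¬ _ _ (λ i → a i zero ≟ 0#) col≉0
  -- Cross-multiplying with the pivot row eliminates the first unknown without division; `punchIn p`
  -- runs through the other rows.
  ...   | p , aₚ≉0 with kernel n (λ i j → a p zero * a (punchIn p i) (suc j) + - a (punchIn p i) zero * a p (suc j))
  ...     | w′ , w′≉0 , a′w′≈0 = w , w≉0 , λ i → trans (expand i) (row i (p Fin.≟ i))
    where
    aw′ : Fin (suc n) → Carrier
    aw′ i = sum λ j → a i (suc j) * w′ j

    -- Back substitution, scaled by the pivot: the pivot row then holds with first coordinate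
    -- `- aw′ p`.
    w : Vector Carrier (suc (suc n))
    w zero    = - aw′ p
    w (suc j) = a p zero * w′ j

    w≉0 : NonZero w
    w≉0 w≈0 = w′≉0 λ j → cancel (w≈0 (suc j))
      where
      cancel : ∀ {x} → a p zero * x ≈ 0# → x ≈ 0#
      cancel {x} ax≈0 with inverse (a p zero) aₚ≉0
      ... | b , ab≈1 = begin-equality
        x                   ≈⟨ *-identityˡ x ⟨
        1# * x              ≈⟨ *-congʳ ab≈1 ⟨
        a p zero * b * x    ≈⟨ solve 3 (λ a b x → a :* b :* x := b :* (a :* x)) refl (a p zero) b x ⟩
        b * (a p zero * x)  ≈⟨ *-congˡ ax≈0 ⟩
        b * 0#              ≈⟨ zeroʳ b ⟩
        0#                  ∎

    expand : ∀ i → sum (λ j → a i j * w j) ≈ a p zero * aw′ i + - a i zero * aw′ p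
    expand i = begin-equality
      a i zero * - aw′ p + sum (λ j → a i (suc j) * (a p zero * w′ j))
        ≈⟨ +-congˡ (sum-cong-≋ λ j → solve 3 (λ x y z → x :* (y :* z) := y :* (x :* z)) refl (a i (suc j)) (a p zero) (w′ j)) ⟩
      a i zero * - aw′ p + sum (λ j → a p zero * (a i (suc j) * w′ j))
        ≈⟨ +-congˡ (*-distribˡ-sum (a p zero) (λ j → a i (suc j) * w′ j)) ⟨
      a i zero * - aw′ p + a p zero * aw′ i
        ≈⟨ solve 4 (λ x y z t → x :* :- y :+ z :* t := z :* t :+ :- x :* y) refl (a i zero) (aw′ p) (a p zero) (aw′ i) ⟩
      a p zero * aw′ i + - a i zero * aw′ p ∎

    row : ∀ i → Dec (p ≡ i) → a p zero * aw′ i + - a i zero * aw′ p ≈ 0#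
    row _ (yes ≡.refl) = solve 2 (λ x y → x :* y :+ :- x :* y := :0) refl (a p zero) (aw′ p)
    row i (no p≢i) with punchOut p≢i | punchIn-punchOut p≢i
    ... | k | ≡.refl = trans (sym (sum-linear _ _ (a (punchIn p k) ∘ suc) (a p ∘ suc) w′)) (a′w′≈0 k)

  -- The columns of M together with b are linearly dependent.
  fredholm : ∀ {n} (M : Matrix Carrier n) (b : Vector Carrier n) →
             (∃[ w ] NonZero w × (∀ i → (M ∙ w) i ≈ 0#)) ⊎ (∃[ y ] ∀ i → (M ∙ y) i ≈ b i)
  fredholm {n} M b with kernel n (λ { i zero → b i ; i (suc j) → M i j })
  ... | w , w≉0 , Mw≈0 with w zero ≟ 0#
  ...   | yes w₀≈0 = inj₁ (w ∘ suc , (λ w≈0 → w≉0 λ { zero → w₀≈0 ; (suc j) → w≈0 j }) , λ i → begin-equality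
    (M ∙ (w ∘ suc)) i                   ≈⟨ +-identityˡ _ ⟨
    0# + (M ∙ (w ∘ suc)) i              ≈⟨ +-congʳ (trans (*-congˡ w₀≈0) (zeroʳ (b i))) ⟨
    b i * w zero + (M ∙ (w ∘ suc)) i    ≈⟨ Mw≈0 i ⟩
    0#                                  ∎)
  -- `b` takes part in the dependence, so dividing by `- w zero` expresses it through the columns of
  -- `M`.
  ...   | no w₀≉0 with inverse (w zero) w₀≉0
  ...     | c , w₀c≈1 = inj₂ ((λ j → - c * w (suc j)) , λ i → begin-equality
    sum (λ j → M i j * (- c * w (suc j)))  ≈⟨ sum-cong-≋ (λ j → solve 3 (λ m c w → m :* (:- c :* w) := :- c :* (m :* w)) refl (M i j) c (w (suc j))) ⟩
    sum (λ j → - c * (M i j * w (suc j)))  ≈⟨ *-distribˡ-sum (- c) (λ j → M i j * w (suc j)) ⟨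
    - c * (M ∙ (w ∘ suc)) i                ≈⟨ solve 4 (λ b w c s → :- c :* s := b :* (w :* c) :- c :* (b :* w :+ s)) refl (b i) (w zero) c _ ⟩
    b i * (w zero * c) - c * (b i * w zero + (M ∙ (w ∘ suc)) i)  ≈⟨ +-cong (*-congˡ w₀c≈1) (-‿cong (*-congˡ (Mw≈0 i))) ⟩
    b i * 1# - c * 0#                      ≈⟨ solve 2 (λ b c → b :* :1 :- c :* :0 := b) refl (b i) c ⟩
    b i                                    ∎)

-- Perron-Frobenius theory of nonnegative matrices.

module PerronFrobenius (ℝ : CompleteOrderedField) where
  open CompleteOrderedField ℝ hiding (zero)
  open OrderedField ℝ
  open IntegerCoefficients commutativeRing
  open Complex ℝ
  open Spectrum ℝ
  open RingProperties ring using (-1*x≈-x)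
  open PartialOrderReasoning poset

  sum-diagonal : ∀ {n} c (x : Vector Carrier n) i →
                 sum (λ j → (if does (i Fin.≟ j) then c else 0#) * x j) ≈ c * x i
  sum-diagonal c x i = trans (sum-single _ i offDiagonal) diagonal
    where
    offDiagonal : ∀ j → j ≢ i → (if does (i Fin.≟ j) then c else 0#) * x j ≈ 0#
    offDiagonal j j≢i rewrite dec-false (i Fin.≟ j) (j≢i ∘ ≡.sym) = zeroˡ (x j)
    diagonal : (if does (i Fin.≟ i) then c else 0#) * x i ≈ c * x i
    diagonal rewrite dec-true (i Fin.≟ i) ≡.refl = refl

  ∙-nonNegative : ∀ {n} {M : Matrix Carrier n} {x} → (∀ i → NonNegative (M i)) → NonNegative x → NonNegative (M ∙ x)
  ∙-nonNegative 0≤M 0≤x i = sum-nonNegative λ j → *-nonNegative (0≤M i j) (0≤x j)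

  IsSubinvariant : ∀ {n} → Matrix Carrier n → Carrier → Vector Carrier n → Set
  IsSubinvariant M r x = NonNegative x × NonZero x × (∀ i → r * x i ≤ (M ∙ x) i)

  -- The index maximises the quotient x j / y j; cross-multiplication keeps inverses out of later
  -- estimates.
  maximal-ratio : ∀ {n} (x y : Vector Carrier (suc n)) → (∀ i → 0# < y i) →
                  ∃[ i ] ∀ j → x j * y i ≤ x i * y j
  maximal-ratio x y 0<y = i , λ j → begin
    x j * y i              ≈⟨ *-congʳ (x≈vy j) ⟩
    v j * y j * y i        ≤⟨ *-monoˡ-≤ (proj₁ (0<y i)) (*-monoˡ-≤ (proj₁ (0<y j)) (proj₂ (maximal v) j)) ⟩
    v i * y j * y i        ≈⟨ solve 3 (λ a b c → a :* b :* c := a :* c :* b) refl (v i) (y j) (y i) ⟩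
    v i * y i * y j        ≈⟨ *-congʳ (x≈vy i) ⟨
    x i * y j              ∎
    where
    v : Vector Carrier _
    v j = x j * proj₁ (positive-inverse (0<y j))
    i = proj₁ (maximal v)
    x≈vy : ∀ j → x j ≈ v j * y j
    x≈vy j = let w , _ , yw≈1 = positive-inverse (0<y j) in begin-equality
      x j              ≈⟨ *-identityʳ (x j) ⟨
      x j * 1#         ≈⟨ *-congˡ yw≈1 ⟨
      x j * (y j * w)  ≈⟨ solve 3 (λ x y w → x :* (y :* w) := x :* w :* y) refl (x j) (y j) w ⟩
      x j * w * y j    ∎

  -- Compare both sides where the ratio x j / y j is largest.
  subinvariant≤superinvariant :
    ∀ {n} {M : Matrix Carrier n} → (∀ i → NonNegative (M i)) →
    ∀ {r x} → IsSubinvariant M r x →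
    ∀ {κ y} → (∀ i → 0# < y i) → (∀ i → (M ∙ y) i ≤ κ * y i) → r ≤ κ
  subinvariant≤superinvariant {zero} _ (_ , x≉0 , _) _ _ = contradiction (λ ()) x≉0
  subinvariant≤superinvariant {suc n} {M} 0≤M {r} {x} (0≤x , x≉0 , rx≤Mx) {κ} {y} 0<y My≤κy =
    *-cancelʳ-≤ (*-positive 0<xᵢ (0<y i)) (begin
      r * (x i * y i)                 ≈⟨ *-assoc r (x i) (y i) ⟨
      r * x i * y i                   ≤⟨ *-monoˡ-≤ (proj₁ (0<y i)) (rx≤Mx i) ⟩
      (M ∙ x) i * y i                 ≈⟨ *-distribʳ-sum (y i) (λ j → M i j * x j) ⟩
      sum (λ j → M i j * x j * y i)   ≤⟨ sum-mono-≤ (λ j → termwise j) ⟩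
      sum (λ j → x i * (M i j * y j)) ≈⟨ *-distribˡ-sum (x i) (λ j → M i j * y j) ⟨
      x i * (M ∙ y) i                 ≤⟨ *-monoʳ-≤ (0≤x i) (My≤κy i) ⟩
      x i * (κ * y i)                 ≈⟨ solve 3 (λ x k y → x :* (k :* y) := k :* (x :* y)) refl (x i) κ (y i) ⟩
      κ * (x i * y i)                 ∎)
    where
    i = proj₁ (maximal-ratio x y 0<y)
    max = proj₂ (maximal-ratio x y 0<y)
    k = proj₁ (nonZero⇒∃ x≉0)
    -- If the largest ratio were 0, the nonzero entry `x k` would have ratio at most 0.
    0<xᵢ : 0# < x i
    0<xᵢ = 0≤x i , λ 0≈xᵢ → <⇒≱ (*-positive (0≤x k , proj₂ (nonZero⇒∃ x≉0) ∘ sym) (0<y i)) (begin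
      x k * y i  ≤⟨ max k ⟩
      x i * y k  ≈⟨ *-congʳ 0≈xᵢ ⟨
      0# * y k   ≈⟨ zeroˡ (y k) ⟩
      0#         ∎)
    termwise : ∀ j → M i j * x j * y i ≤ x i * (M i j * y j)
    termwise j = begin
      M i j * x j * y i    ≈⟨ *-assoc _ _ _ ⟩
      M i j * (x j * y i)  ≤⟨ *-monoʳ-≤ (0≤M i j) (max j) ⟩
      M i j * (x i * y j)  ≈⟨ solve 3 (λ m x y → m :* (x :* y) := x :* (m :* y)) refl (M i j) (x i) (y j) ⟩
      x i * (M i j * y j)  ∎

  negativePart : Carrier → Carrier
  negativePart y = if does (y ≤? 0#) then - y else 0#

  negativePart-nonNegative : ∀ y → 0# ≤ negativePart y
  negativePart-nonNegative y with y ≤? 0#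
  ... | yes y≤0 = neg-nonNegative y≤0
  ... | no  _   = ≤-refl

  -y≤negativePart : ∀ y → - y ≤ negativePart y
  -y≤negativePart y with y ≤? 0#
  ... | yes _   = ≤-refl
  ... | no  y≰0 = 0≤y-x⇒x≤y (≤-trans (≰⇒≥ y≰0) (≤-reflexive (solve 1 (λ y → y := :0 :- (:- y)) refl y)))

  negativePart-cases : ∀ y → negativePart y ≈ 0# ⊎ negativePart y ≈ - y
  negativePart-cases y with y ≤? 0#
  ... | yes _ = inj₂ refl
  ... | no  _ = inj₁ refl

  module _ {n} {M : Matrix Carrier n} (0≤M : ∀ i → NonNegative (M i))
           {r x} (r-sub : IsSubinvariant M r x) where

    private
      -- The all-one vector is superinvariant for the sum of all entries of `M`, which gives
      -- `supremum` its upper bound.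
      total-bound : ∀ {s} → (∃[ x ] IsSubinvariant M s x) → s ≤ sum (λ i → sum (M i))
      total-bound (x , s-sub) = subinvariant≤superinvariant 0≤M s-sub {y = λ _ → 1#} (λ _ → 0<1) λ i → begin
        sum (λ j → M i j * 1#)       ≈⟨ sum-cong-≋ (λ j → *-identityʳ (M i j)) ⟩
        sum (M i)                    ≤⟨ entry≤sum (λ k → sum-nonNegative (0≤M k)) i ⟩
        sum (λ i → sum (M i))        ≈⟨ *-identityʳ _ ⟨
        sum (λ i → sum (M i)) * 1#   ∎

      sup = supremum (λ s → ∃[ x ] IsSubinvariant M s x) (r , x , r-sub) (_ , total-bound)

    -- The Collatz-Wielandt number of `M`; the given subinvariant vector shows that the supremum is
    -- over a nonempty set.
    perronRoot : Carrier
    perronRoot = proj₁ sup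

    private
      t = perronRoot

    ≤perronRoot : ∀ {s x} → IsSubinvariant M s x → s ≤ t
    ≤perronRoot s-sub = proj₁ (proj₂ sup) (_ , s-sub)

    perronRoot≤ : ∀ {b} → (∀ {s x} → IsSubinvariant M s x → s ≤ b) → t ≤ b
    perronRoot≤ ub = proj₂ (proj₂ sup) λ { (_ , s-sub) → ub s-sub }

    -- Since M x ≥ 0, the given vector is subinvariant for 0 as well.
    perronRoot-nonNegative : 0# ≤ t
    perronRoot-nonNegative = let 0≤x , x≉0 , _ = r-sub in
      ≤perronRoot (0≤x , x≉0 , λ i → ≤-trans (≤-reflexive (zeroˡ (x i))) (∙-nonNegative 0≤M 0≤x i))

    private
      -- This is t - M, written as a combination of two rows to match `sum-linear`.
      shifted : Matrix Carrier n
      shifted i j = t * (if does (i Fin.≟ j) then 1# else 0#) + - 1# * M i j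

      shifted-∙ : ∀ w i → (shifted ∙ w) i ≈ t * w i - (M ∙ w) i
      shifted-∙ w i = begin-equality
        (shifted ∙ w) i                ≈⟨ sum-linear t (- 1#) _ (M i) w ⟩
        t * sum (λ j → (if does (i Fin.≟ j) then 1# else 0#) * w j) + - 1# * (M ∙ w) i
                                       ≈⟨ +-cong (*-congˡ (trans (sum-diagonal 1# w i) (*-identityˡ (w i)))) (-1*x≈-x ((M ∙ w) i)) ⟩
        t * w i - (M ∙ w) i            ∎

      module Resolvent (y : Vector Carrier n) (ty-My≈1 : ∀ i → t * y i - (M ∙ y) i ≈ 1#) where

        y⁻ : Vector Carrier n
        y⁻ = negativePart ∘ y

        y⁻≥0 : NonNegative y⁻
        y⁻≥0 i = negativePart-nonNegative (y i)

        -- Otherwise y⁻ would be subinvariant for some t + ε.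
        y⁻≈0 : ¬ NonZero y⁻
        y⁻≈0 y⁻≉0 = <⇒≱ 0<ε (begin
          ε            ≈⟨ solve 2 (λ t e → e := (t :+ e) :- t) refl t ε ⟩
          (t + ε) - t  ≤⟨ +-monoˡ-≤ (- t) (≤perronRoot (y⁻≥0 , y⁻≉0 , λ i → sub i (negativePart-cases (y i)))) ⟩
          t - t        ≈⟨ -‿inverseʳ t ⟩
          0#           ∎)
          where
          ε = proj₁ (small-multiple y⁻≥0)
          0<ε = proj₁ (proj₂ (small-multiple y⁻≥0))
          εy⁻≤1 = proj₂ (proj₂ (small-multiple y⁻≥0))

          sub : ∀ i → y⁻ i ≈ 0# ⊎ y⁻ i ≈ - y i → (t + ε) * y⁻ i ≤ (M ∙ y⁻) i
          sub i (inj₁ y⁻≈0) = begin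
            (t + ε) * y⁻ i  ≈⟨ *-congˡ y⁻≈0 ⟩
            (t + ε) * 0#    ≈⟨ zeroʳ (t + ε) ⟩
            0#              ≤⟨ ∙-nonNegative 0≤M y⁻≥0 i ⟩
            (M ∙ y⁻) i      ∎
          -- The right-hand side 1 of the linear system absorbs the extra ε y⁻, and what remains is
          -- - (M y) i ≤ (M y⁻) i.
          sub i (inj₂ y⁻≈-y) = begin
            (t + ε) * y⁻ i                    ≈⟨ distribʳ _ _ _ ⟩
            t * y⁻ i + ε * y⁻ i               ≤⟨ +-mono-≤ (≤-reflexive (*-congˡ y⁻≈-y)) (εy⁻≤1 i) ⟩
            t * - y i + 1#                    ≈⟨ +-congˡ (ty-My≈1 i) ⟨
            t * - y i + (t * y i - (M ∙ y) i) ≈⟨ solve 3 (λ t y m → t :* :- y :+ (t :* y :- m) := :- :1 :* m) refl t (y i) _ ⟩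
            - 1# * (M ∙ y) i                  ≈⟨ *-distribˡ-sum (- 1#) (λ j → M i j * y j) ⟩
            sum (λ j → - 1# * (M i j * y j))  ≈⟨ sum-cong-≋ (λ j → solve 2 (λ m y → :- :1 :* (m :* y) := m :* :- y) refl (M i j) (y j)) ⟩
            sum (λ j → M i j * - y j)         ≤⟨ sum-mono-≤ (λ j → *-monoʳ-≤ (0≤M i j) (-y≤negativePart (y j))) ⟩
            (M ∙ y⁻) i                        ∎

        0≤y : NonNegative y
        0≤y i with y⁻ i ≟ 0#
        ... | no  y⁻ᵢ≉0 = contradiction (λ y⁻≈0 → y⁻ᵢ≉0 (y⁻≈0 i)) y⁻≈0
        ... | yes y⁻ᵢ≈0 = 0≤y-x⇒x≤y (begin
          0#           ≤⟨ x≤y⇒0≤y-x (-y≤negativePart (y i)) ⟩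
          y⁻ i - - y i ≈⟨ +-congʳ y⁻ᵢ≈0 ⟩
          0# - - y i   ≈⟨ solve 1 (λ y → :0 :- :- y := y :- :0) refl (y i) ⟩
          y i - 0#     ∎)

        -- At a zero entry the equation would read 1 = - (M y) i, whose right side is at most 0.
        0<y : ∀ i → 0# < y i
        0<y i = 0≤y i , λ 0≈yᵢ → 1≰0 (begin
          1#                    ≈⟨ ty-My≈1 i ⟨
          t * y i - (M ∙ y) i   ≤⟨ 0≤y-x⇒x≤y (≤-trans (∙-nonNegative 0≤M 0≤y i) (≤-reflexive (solve 2 (λ m a → m := a :- (a :- m)) refl ((M ∙ y) i) (t * y i)))) ⟩
          t * y i               ≈⟨ *-congˡ 0≈yᵢ ⟨
          t * 0#                ≈⟨ zeroʳ t ⟩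
          0#                    ∎)

        -- y is strictly superinvariant, so t - δ is still an upper bound.
        absurd : ⊥
        absurd = <⇒≱ 0<δ (begin
          δ             ≈⟨ solve 2 (λ t d → d := t :- (t :- d)) refl t δ ⟩
          t - (t - δ)   ≤⟨ +-monoˡ-≤ (- (t - δ)) (perronRoot≤ λ s-sub → subinvariant≤superinvariant 0≤M s-sub 0<y super) ⟩
          (t - δ) - (t - δ) ≈⟨ -‿inverseʳ (t - δ) ⟩
          0#            ∎)
          where
          δ = proj₁ (small-multiple 0≤y)
          0<δ = proj₁ (proj₂ (small-multiple 0≤y))
          δy≤1 = proj₂ (proj₂ (small-multiple 0≤y))

          super : ∀ i → (M ∙ y) i ≤ (t - δ) * y i
          super i = 0≤y-x⇒x≤y (begin
            0#                                              ≤⟨ x≤y⇒0≤y-x (δy≤1 i) ⟩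
            1# - δ * y i                                    ≈⟨ +-congʳ (ty-My≈1 i) ⟨
            (t * y i - (M ∙ y) i) - δ * y i                 ≈⟨ solve 4 (λ t y m d → (t :* y :- m) :- d :* y := (t :- d) :* y :- m) refl t (y i) ((M ∙ y) i) δ ⟩
            (t - δ) * y i - (M ∙ y) i                       ∎)

    -- The alternative is applied to t - M and the all-one vector; `Resolvent` excludes a solution,
    -- so a kernel vector remains.
    perronVector : ∃[ w ] NonZero w × (∀ i → (M ∙ w) i ≈ t * w i)
    perronVector with fredholm shifted (λ _ → 1#)
    ... | inj₁ (w , w≉0 , Kw≈0) = w , w≉0 , λ i → begin-equality
      (M ∙ w) i                            ≈⟨ solve 2 (λ m a → m := a :- (a :- m)) refl ((M ∙ w) i) (t * w i) ⟩
      t * w i - (t * w i - (M ∙ w) i)      ≈⟨ +-congˡ (-‿cong (trans (sym (shifted-∙ w i)) (Kw≈0 i))) ⟩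
      t * w i - 0#                         ≈⟨ solve 1 (λ a → a :- :0 := a) refl (t * w i) ⟩
      t * w i                              ∎
    ... | inj₂ (y , Ky≈1) = ⊥-elim
      (Resolvent.absurd y λ i → trans (sym (shifted-∙ y i)) (Ky≈1 i))

  -- Passage between real and complex eigenvectors.

  re-sumᶜ : ∀ {n} (z : Vector ℂ n) → re (sumᶜ z) ≡ sum (re ∘ z)
  re-sumᶜ {zero}  z = ≡.refl
  re-sumᶜ {suc n} z = ≡.cong (re (z zero) +_) (re-sumᶜ (z ∘ suc))

  im-sumᶜ : ∀ {n} (z : Vector ℂ n) → im (sumᶜ z) ≡ sum (im ∘ z)
  im-sumᶜ {zero}  z = ≡.refl
  im-sumᶜ {suc n} z = ≡.cong (im (z zero) +_) (im-sumᶜ (z ∘ suc))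

  re-∙ : ∀ {n} (M : Matrix Carrier n) (z : Vector ℂ n) i →
         re (sumᶜ (λ j → fromReal (M i j) *ᶜ z j)) ≈ (M ∙ (re ∘ z)) i
  re-∙ M z i = trans (reflexive (re-sumᶜ (λ j → fromReal (M i j) *ᶜ z j))) (sum-cong-≋ λ j →
    solve 3 (λ m a b → m :* a :- :0 :* b := m :* a) refl (M i j) (re (z j)) (im (z j)))

  im-∙ : ∀ {n} (M : Matrix Carrier n) (z : Vector ℂ n) i →
         im (sumᶜ (λ j → fromReal (M i j) *ᶜ z j)) ≈ (M ∙ (im ∘ z)) i
  im-∙ M z i = trans (reflexive (im-sumᶜ (λ j → fromReal (M i j) *ᶜ z j))) (sum-cong-≋ λ j →
    solve 3 (λ m a b → m :* b :+ :0 :* a := m :* b) refl (M i j) (re (z j)) (im (z j)))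

  realEigenvalue : ∀ {n} {M : Matrix Carrier n} {t w} → NonZero w →
                   (∀ i → (M ∙ w) i ≈ t * w i) → IsEigenvalue M (fromReal t)
  realEigenvalue {M = M} {t} {w} w≉0 Mw≈tw =
    z , (λ z≈0 → w≉0 (proj₁ ∘ z≈0)) , λ i → realPart i , imaginaryPart i
    where
    z = fromReal ∘ w
    realPart : ∀ i → re (sumᶜ (λ j → fromReal (M i j) *ᶜ z j)) ≈ t * w i - 0# * 0#
    realPart i = begin-equality
      re (sumᶜ (λ j → fromReal (M i j) *ᶜ z j))  ≈⟨ re-∙ M z i ⟩
      (M ∙ w) i                                  ≈⟨ Mw≈tw i ⟩
      t * w i                                    ≈⟨ solve 1 (λ a → a := a :- :0 :* :0) refl (t * w i) ⟩
      t * w i - 0# * 0#                          ∎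
    imaginaryPart : ∀ i → im (sumᶜ (λ j → fromReal (M i j) *ᶜ z j)) ≈ t * 0# + 0# * w i
    imaginaryPart i = begin-equality
      im (sumᶜ (λ j → fromReal (M i j) *ᶜ z j))  ≈⟨ im-∙ M z i ⟩
      (M ∙ (λ _ → 0#)) i                         ≈⟨ sum-zero (λ j → zeroʳ (M i j)) ⟩
      0#                                         ≈⟨ solve 2 (λ t w → :0 := t :* :0 :+ :0 :* w) refl t (w i) ⟩
      t * 0# + 0# * w i                          ∎

  -- The Perron root is at least r, and it is an eigenvalue whose modulus is itself because it is
  -- nonnegative.
  collatz-wielandt : ∀ {n} {M : Matrix Carrier n} {r ρ x} → (∀ i → NonNegative (M i)) →
                     IsSubinvariant M r x → IsSpectralRadius M ρ → r ≤ ρ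
  collatz-wielandt {M = M} {r} {ρ} 0≤M r-sub (_ , ρ-max) = begin
    r  ≤⟨ ≤perronRoot 0≤M r-sub r-sub ⟩
    t  ≤⟨ ρ-max (fromReal t) t (realEigenvalue (proj₁ (proj₂ v)) (proj₂ (proj₂ v)))
            (perronRoot-nonNegative 0≤M r-sub , solve 1 (λ t → t :* t := t :* t :+ :0 :* :0) refl t) ⟩
    ρ  ∎
    where
    t = perronRoot 0≤M r-sub
    v = perronVector 0≤M r-sub

-- Moduli of complex numbers and of eigenvectors.

module Modulus (ℝ : CompleteOrderedField) where
  open CompleteOrderedField ℝ hiding (zero)
  open OrderedField ℝ
  open PerronFrobenius ℝ
  open IntegerCoefficients commutativeRing
  open Complex ℝ
  open Spectrum ℝ
  open PartialOrderReasoning poset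

  -- Lets an estimate be proved in doubled form without introducing the inverse of 2.
  halve-nonNegative : ∀ {x} → 0# ≤ x + x → 0# ≤ x
  halve-nonNegative {x} 0≤2x with total 0# x
  ... | inj₁ 0≤x = 0≤x
  ... | inj₂ x≤0 = begin
    0#      ≤⟨ 0≤2x ⟩
    x + x   ≤⟨ +-mono-≤ x≤0 ≤-refl ⟩
    0# + x  ≈⟨ +-identityˡ x ⟩
    x       ∎

  -- The closed unit disc gives the same supremum as the circle and contains (0 , 0), which yields
  -- nonemptiness and nonnegativity at once.
  IsProjection : ℂ → Carrier → Set
  IsProjection z v = ∃[ c ] ∃[ s ] c * c + s * s ≤ 1# × v ≈ c * re z + s * im z

  -- A polynomial bound avoids square roots: twice the slack is the squared distance of z from (c ,
  -- s), plus 1 - (c² + s²), plus the bound itself.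
  projection-bounded : ∀ z {v} → IsProjection z v → v ≤ 1# + (re z * re z + im z * im z)
  projection-bounded z {v} (c , s , cs≤1 , v≈) = 0≤y-x⇒x≤y (≤-trans (halve-nonNegative (begin
    0#
      ≤⟨ +-nonNegative (+-nonNegative (square-nonNegative (a - c)) (square-nonNegative (b - s)))
           (+-nonNegative (x≤y⇒0≤y-x cs≤1)
             (+-nonNegative 0≤1 (+-nonNegative (square-nonNegative a) (square-nonNegative b)))) ⟩
    ((a - c) * (a - c) + (b - s) * (b - s)) + ((1# - (c * c + s * s)) + (1# + (a * a + b * b)))
      ≈⟨ solve 4 (λ a b c s →
           ((a :- c) :* (a :- c) :+ (b :- s) :* (b :- s)) :+ ((:1 :- (c :* c :+ s :* s)) :+ (:1 :+ (a :* a :+ b :* b)))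
           := ((:1 :+ (a :* a :+ b :* b)) :- (c :* a :+ s :* b)) :+ ((:1 :+ (a :* a :+ b :* b)) :- (c :* a :+ s :* b)))
           refl a b c s ⟩
    (k - (c * a + s * b)) + (k - (c * a + s * b)) ∎)) (≤-reflexive (+-congˡ (-‿cong (sym v≈)))))
    where
    a = re z
    b = im z
    k = 1# + (a * a + b * b)

  private
    sup : ∀ z → ∃[ s ] IsUpperBound (IsProjection z) s × (∀ {b} → IsUpperBound (IsProjection z) b → s ≤ b)
    sup z = supremum (IsProjection z)
      (_ , 0# , 0# , ≤-trans (≤-reflexive (solve 0 (:0 :* :0 :+ :0 :* :0 := :0) refl)) 0≤1 , refl)
      (_ , projection-bounded z)

  -- The modulus of z as the largest projection onto a unit vector; unlike with
  -- √(re² + im²), subadditivity needs no proof.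
  ∣_∣ : ℂ → Carrier
  ∣ z ∣ = proj₁ (sup z)

  projection≤∣∣ : ∀ z {c s} → c * c + s * s ≤ 1# → c * re z + s * im z ≤ ∣ z ∣
  projection≤∣∣ z cs≤1 = proj₁ (proj₂ (sup z)) (_ , _ , cs≤1 , refl)

  ∣∣-least : ∀ z {b} → (∀ {c s} → c * c + s * s ≤ 1# → c * re z + s * im z ≤ b) → ∣ z ∣ ≤ b
  ∣∣-least z {b} ub = proj₂ (proj₂ (sup z)) λ { (_ , _ , cs≤1 , v≈) → ≤-trans (≤-reflexive v≈) (ub cs≤1) }

  ∣∣-nonNegative : ∀ z → 0# ≤ ∣ z ∣
  ∣∣-nonNegative z = begin
    0#                       ≈⟨ solve 2 (λ a b → :0 := :0 :* a :+ :0 :* b) refl (re z) (im z) ⟩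
    0# * re z + 0# * im z    ≤⟨ projection≤∣∣ z (≤-trans (≤-reflexive (solve 0 (:0 :* :0 :+ :0 :* :0 := :0) refl)) 0≤1) ⟩
    ∣ z ∣                    ∎

  -- Projecting onto (1 , 0), (-1 , 0), (0 , 1) and (0 , -1) bounds both coordinates and their
  -- negatives by 0.
  ∣∣≈0⇒≈0 : ∀ z → ∣ z ∣ ≈ 0# → z ≈ᶜ 0ᶜ
  ∣∣≈0⇒≈0 z ∣z∣≈0 =
    antisym (bound (solve 2 (λ a b → a := :1 :* a :+ :0 :* b) refl a b) (solve 0 (:1 :* :1 :+ :0 :* :0 := :1) refl))
            (flip (bound (solve 2 (λ a b → :- a := :- :1 :* a :+ :0 :* b) refl a b) (solve 0 (:- :1 :* :- :1 :+ :0 :* :0 := :1) refl))) ,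
    antisym (bound (solve 2 (λ a b → b := :0 :* a :+ :1 :* b) refl a b) (solve 0 (:0 :* :0 :+ :1 :* :1 := :1) refl))
            (flip (bound (solve 2 (λ a b → :- b := :0 :* a :+ :- :1 :* b) refl a b) (solve 0 (:0 :* :0 :+ :- :1 :* :- :1 := :1) refl)))
    where
    a = re z
    b = im z
    bound : ∀ {v c s} → v ≈ c * a + s * b → c * c + s * s ≈ 1# → v ≤ 0#
    bound {v} {c} {s} v≈ cs≈1 = begin
      v              ≈⟨ v≈ ⟩
      c * a + s * b  ≤⟨ projection≤∣∣ z (≤-reflexive cs≈1) ⟩
      ∣ z ∣          ≈⟨ ∣z∣≈0 ⟩
      0#             ∎
    flip : ∀ {v} → - v ≤ 0# → 0# ≤ v
    flip {v} -v≤0 = ≤-trans (neg-nonNegative -v≤0) (≤-reflexive (solve 1 (λ v → :- :- v := v) refl v))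

  module _ {n} {M : Matrix Carrier n} (0≤M : ∀ i → NonNegative (M i))
           {μ ρ} (∣μ∣≈ρ : IsModulus μ ρ) (0<ρ : 0# < ρ)
           {z : Vector ℂ n} (Mz≈μz : ∀ i → sumᶜ (λ j → fromReal (M i j) *ᶜ z j) ≈ᶜ μ *ᶜ z i) where

    private
      p = re μ
      q = im μ
      ρ⁻¹ = proj₁ (positive-inverse 0<ρ)
      0<ρ⁻¹ = proj₁ (proj₂ (positive-inverse 0<ρ))
      ρρ⁻¹≈1 = proj₂ (proj₂ (positive-inverse 0<ρ))

      -- Multiplication by μ rotates and scales by ρ. So ρ times the projection of `z i` onto (c ,
      -- s) is the projection of μ z i = (M z) i onto the rotated vector, which is estimated term by
      -- term.
      projection-sub : ∀ i {c s} → c * c + s * s ≤ 1# →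
                       c * re (z i) + s * im (z i) ≤ ρ⁻¹ * (M ∙ (∣_∣ ∘ z)) i
      projection-sub i {c} {s} cs≤1 = begin
        c * a + s * b
          -- The factor 1 becomes (ρ ρ⁻¹)², whose ρ² can be traded for p² + q².
          ≈⟨ solve 1 (λ v → v := :1 :* :1 :* v) refl _ ⟩
        1# * 1# * (c * a + s * b)
          ≈⟨ *-congʳ (*-cong ρρ⁻¹≈1 ρρ⁻¹≈1) ⟨
        ρ * ρ⁻¹ * (ρ * ρ⁻¹) * (c * a + s * b)
          ≈⟨ solve 3 (λ r k v → r :* k :* (r :* k) :* v := k :* (k :* (r :* r) :* v)) refl ρ ρ⁻¹ _ ⟩
        ρ⁻¹ * (ρ⁻¹ * (ρ * ρ) * (c * a + s * b))
          ≈⟨ *-congˡ (*-congʳ (*-congˡ (proj₂ ∣μ∣≈ρ))) ⟩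
        ρ⁻¹ * (ρ⁻¹ * (p * p + q * q) * (c * a + s * b))
          ≈⟨ *-congˡ (solve 7 (λ k p q c s a b → k :* (p :* p :+ q :* q) :* (c :* a :+ s :* b)
               := k :* (p :* c :- q :* s) :* (p :* a :- q :* b) :+ k :* (q :* c :+ p :* s) :* (p :* b :+ q :* a))
               refl ρ⁻¹ p q c s a b) ⟩
        ρ⁻¹ * (c′ * (p * a - q * b) + s′ * (p * b + q * a))
          ≈⟨ *-congˡ (+-cong (*-congˡ (trans (sym (proj₁ (Mz≈μz i))) (re-∙ M z i)))
                             (*-congˡ (trans (sym (proj₂ (Mz≈μz i))) (im-∙ M z i)))) ⟩
        ρ⁻¹ * (c′ * (M ∙ (re ∘ z)) i + s′ * (M ∙ (im ∘ z)) i)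
          ≈⟨ *-congˡ (+-cong (*-distribˡ-sum c′ (λ j → M i j * re (z j))) (*-distribˡ-sum s′ (λ j → M i j * im (z j)))) ⟩
        ρ⁻¹ * (sum (λ j → c′ * (M i j * re (z j))) + sum (λ j → s′ * (M i j * im (z j))))
          ≈⟨ *-congˡ (∑-distrib-+ (λ j → c′ * (M i j * re (z j))) (λ j → s′ * (M i j * im (z j)))) ⟨
        ρ⁻¹ * sum (λ j → c′ * (M i j * re (z j)) + s′ * (M i j * im (z j)))
          ≤⟨ *-monoʳ-≤ (proj₁ 0<ρ⁻¹) (sum-mono-≤ termwise) ⟩
        ρ⁻¹ * (M ∙ (∣_∣ ∘ z)) i ∎
        where
        a = re (z i)
        b = im (z i)
        -- (c , s) rotated by the argument of μ
        c′ = ρ⁻¹ * (p * c - q * s)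
        s′ = ρ⁻¹ * (q * c + p * s)

        c′s′≤1 : c′ * c′ + s′ * s′ ≤ 1#
        c′s′≤1 = begin
          c′ * c′ + s′ * s′
            ≈⟨ solve 5 (λ k p q c s → k :* (p :* c :- q :* s) :* (k :* (p :* c :- q :* s)) :+ k :* (q :* c :+ p :* s) :* (k :* (q :* c :+ p :* s))
                 := k :* k :* (p :* p :+ q :* q) :* (c :* c :+ s :* s)) refl ρ⁻¹ p q c s ⟩
          ρ⁻¹ * ρ⁻¹ * (p * p + q * q) * (c * c + s * s)
            ≈⟨ *-congʳ (*-congˡ (proj₂ ∣μ∣≈ρ)) ⟨
          ρ⁻¹ * ρ⁻¹ * (ρ * ρ) * (c * c + s * s)
            ≈⟨ *-congʳ (solve 2 (λ k r → k :* k :* (r :* r) := r :* k :* (r :* k)) refl ρ⁻¹ ρ) ⟩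
          ρ * ρ⁻¹ * (ρ * ρ⁻¹) * (c * c + s * s)
            ≈⟨ *-congʳ (*-cong ρρ⁻¹≈1 ρρ⁻¹≈1) ⟩
          1# * 1# * (c * c + s * s)
            ≈⟨ solve 1 (λ v → :1 :* :1 :* v := v) refl _ ⟩
          c * c + s * s
            ≤⟨ cs≤1 ⟩
          1# ∎

        termwise : ∀ j → c′ * (M i j * re (z j)) + s′ * (M i j * im (z j)) ≤ M i j * ∣ z j ∣
        termwise j = begin
          c′ * (M i j * re (z j)) + s′ * (M i j * im (z j))
            ≈⟨ solve 5 (λ c s m a b → c :* (m :* a) :+ s :* (m :* b) := m :* (c :* a :+ s :* b)) refl c′ s′ (M i j) (re (z j)) (im (z j)) ⟩
          M i j * (c′ * re (z j) + s′ * im (z j))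
            ≤⟨ *-monoʳ-≤ (0≤M i j) (projection≤∣∣ (z j) c′s′≤1) ⟩
          M i j * ∣ z j ∣ ∎

    ρ∣z∣≤M∣z∣ : ∀ i → ρ * ∣ z i ∣ ≤ (M ∙ (∣_∣ ∘ z)) i
    ρ∣z∣≤M∣z∣ i = begin
      ρ * ∣ z i ∣                      ≤⟨ *-monoʳ-≤ (proj₁ 0<ρ) (∣∣-least (z i) (projection-sub i)) ⟩
      ρ * (ρ⁻¹ * (M ∙ (∣_∣ ∘ z)) i)    ≈⟨ *-assoc _ _ _ ⟨
      ρ * ρ⁻¹ * (M ∙ (∣_∣ ∘ z)) i      ≈⟨ *-congʳ ρρ⁻¹≈1 ⟩
      1# * (M ∙ (∣_∣ ∘ z)) i           ≈⟨ *-identityˡ _ ⟩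
      (M ∙ (∣_∣ ∘ z)) i                ∎

  eigenvalue⇒subinvariant : ∀ {n} {M : Matrix Carrier n} → (∀ i → NonNegative (M i)) →
                            ∀ {μ ρ} → IsEigenvalue M μ → IsModulus μ ρ → 0# < ρ → ∃[ x ] IsSubinvariant M ρ x
  eigenvalue⇒subinvariant {M = M} 0≤M {μ} {ρ} (z , z≉0 , Mz≈μz) ∣μ∣≈ρ 0<ρ =
    ∣_∣ ∘ z , (λ i → ∣∣-nonNegative (z i)) , (λ ∣z∣≈0 → z≉0 λ i → ∣∣≈0⇒≈0 (z i) (∣z∣≈0 i)) ,
    ρ∣z∣≤M∣z∣ {M = M} 0≤M {μ} {ρ} ∣μ∣≈ρ 0<ρ {z} Mz≈μz

-- Directed walks in trees.

module _ {n : ℕ} (T : Digraph n) where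
  open Digraph T
  open import Data.Nat.Base using (_+_; _<_)
  open ≡ using (refl; sym; trans; cong; subst; subst₂)

  module _ (asymmetric : Asymmetric _⟶_) (acyclic : ¬ Cycle)
           (f : ℕ → Fin n) (walk : ∀ t → f t ⟶ f (suc t)) where

    -- A shortest closed segment has distinct vertices, hence is a cycle of
    -- the underlying graph.
    walk-noRepeat : ∀ ℓ i → f i ≢ f (suc ℓ + i)
    walk-noRepeat = <-rec _ shorten
      where
      shorten : ∀ ℓ → (∀ {k} → k < ℓ → ∀ i → f i ≢ f (suc k + i)) → ∀ i → f i ≢ f (suc ℓ + i)
      -- The closed segment has length `suc ℓ`. Lengths 1 and 2 contradict looplessness and
      -- asymmetry; from 3 on a `Cycle` can be formed.
      shorten 0 _ i eq = loopless eq (walk i)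
      shorten 1 _ i eq = asymmetric (walk i) (subst (f (suc i) ⟶_) (sym eq) (walk (suc i)))
      shorten (suc (suc k)) shorter i eq = acyclic record
        { vertex   = v
        ; distinct = distinct
        ; step     = λ t → fwd (subst (λ s → f (s + i) ⟶ v (suc t)) (sym (toℕ-inject₁ t)) (walk (toℕ t + i)))
        ; close    = fwd (subst₂ _⟶_ (cong (λ s → f (s + i)) (sym (toℕ-fromℕ (2 + k)))) (sym eq) (walk (2 + k + i)))
        }
        where
        v : Fin (3 + k) → Fin n
        v t = f (toℕ t + i)

        -- A repetition would close a segment of length `suc d` ≤ 2 + k, which the induction
        -- hypothesis excludes.
        ordered : ∀ {a b : Fin (3 + k)} → toℕ a < toℕ b → v a ≢ v b
        ordered {a} {b} a<b va≡vb = shorter d<ℓ (toℕ a + i) (trans va≡vb (cong f shift))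
          where
          d = toℕ b ℕ.∸ suc (toℕ a)
          b≡ : toℕ b ≡ suc d + toℕ a
          b≡ = trans (sym (ℕₚ.m∸n+n≡m a<b)) (ℕₚ.+-suc d (toℕ a))
          shift : toℕ b + i ≡ suc d + (toℕ a + i)
          shift = trans (cong (_+ i) b≡) (ℕₚ.+-assoc (suc d) (toℕ a) i)
          d<ℓ : d < 2 + k
          d<ℓ = ℕₚ.≤-trans (ℕₚ.≤-trans (ℕₚ.m≤m+n (suc d) (toℕ a)) (ℕₚ.≤-reflexive (sym b≡))) (ℕₚ.≤-pred (toℕ<n b))

        distinct : ∀ {a b} → v a ≡ v b → a ≡ b
        distinct {a} {b} va≡vb with ℕₚ.<-cmp (toℕ a) (toℕ b)
        ... | tri< a<b _ _ = contradiction va≡vb (ordered a<b)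
        ... | tri≈ _ a≡b _ = toℕ-injective a≡b
        ... | tri> _ _ b<a = contradiction (sym va≡vb) (ordered b<a)

    -- Two of the first n + 1 positions carry the same vertex.
    noInfiniteWalk : ⊥
    noInfiniteWalk with pigeonhole (ℕₚ.n<1+n n) (f ∘ toℕ)
    ... | i , j , i<j , fi≡fj = contradiction
      (trans fi≡fj (cong f (trans (sym (ℕₚ.m∸n+n≡m i<j)) (ℕₚ.+-suc _ (toℕ i)))))
      (walk-noRepeat (toℕ j ℕ.∸ suc (toℕ i)) (toℕ i))

  -- From any vertex of `P`, choosing successors within `P` forever would give an infinite walk.
  successorClosed⇒empty : Asymmetric _⟶_ → ¬ Cycle → ∀ {P : Fin n → Set} →
                 (∀ {a} → P a → ∃[ b ] a ⟶ b × P b) → ∀ a → ¬ P a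
  successorClosed⇒empty asymmetric acyclic {P} next a₀ Pa₀ =
    noInfiniteWalk asymmetric acyclic (proj₁ ∘ f) λ t → proj₁ (proj₂ (next (proj₂ (f t))))
    where
    f : ℕ → ∃ P
    f zero    = a₀ , Pa₀
    f (suc t) = let b , _ , Pb = next (proj₂ (f t)) in b , Pb

-- Meant for an out-neighbour `k` of `i`, where looplessness rules out k = i and two cases remain.
transpose-elim : ∀ {n} (P : Fin n → Set) {i j k} → k ≢ i →
                 (k ≡ j → P i) → (k ≢ j → P k) → P (PC.transpose i j k)
transpose-elim P {i} {j} {k} k≢i at-j otherwise rewrite dec-false (k Fin.≟ i) k≢i with k Fin.≟ j
... | yes k≡j = at-j k≡j
... | no  k≢j = otherwise k≢j

-- The matrix A_α of a digraph.

module AlphaMatrix (ℝ : CompleteOrderedField) where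
  open CompleteOrderedField ℝ hiding (zero)
  open OrderedField ℝ
  open PerronFrobenius ℝ
  open Spectrum ℝ
  open PartialOrderReasoning poset
  open RawMonoidDefinitions +-rawMonoid using () renaming (_×_ to _·_)

  -- A general `f` carries the induction, since the tail of `tabulate id` is `tabulate suc`.
  count≈sum : ∀ {m n} {P : Fin m → Set} (P? : Decidable P) (f : Fin n → Fin m) →
              count P? (tabulate f) · 1# ≈ sum (λ i → if does (P? (f i)) then 1# else 0#)
  count≈sum {n = zero}  P? f = refl
  count≈sum {n = suc n} P? f with does (P? (f zero))
  ... | true  = +-congˡ (count≈sum P? (f ∘ suc))
  ... | false = trans (count≈sum P? (f ∘ suc)) (sym (+-identityˡ _))

  module _ {n} (G : Digraph n) where
    open Digraph G
    open DigraphMatrices ℝ G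

    -- The outdegree as a row sum, a form that can be permuted and compared entry by entry.
    degree : Fin n → Carrier
    degree u = sum (A u)

    outdegree≈degree : ∀ u → outdegree u · 1# ≈ degree u
    outdegree≈degree u = count≈sum (u ⟶?_) id

    A-nonNegative : ∀ u w → 0# ≤ A u w
    A-nonNegative u w with u ⟶? w
    ... | yes _ = 0≤1
    ... | no  _ = ≤-refl

    A-arc : ∀ {u w} → u ⟶ w → A u w ≈ 1#
    A-arc {u} {w} u⟶w rewrite dec-true (u ⟶? w) u⟶w = refl

    A*-≤ : ∀ {u w x b} → 0# ≤ b → (u ⟶ w → x ≤ b) → A u w * x ≤ b
    A*-≤ {u} {w} {x} 0≤b x≤b with u ⟶? w
    ... | yes u⟶w = ≤-trans (≤-reflexive (*-identityˡ x)) (x≤b u⟶w)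
    ... | no  _   = ≤-trans (≤-reflexive (zeroˡ x)) 0≤b

    Aα-∙ : ∀ α x u → (Aα α ∙ x) u ≈ α * degree u * x u + (1# - α) * (A ∙ x) u
    Aα-∙ α x u = begin-equality
      (Aα α ∙ x) u                                           ≈⟨ sum-linear α (1# - α) (D⁺ u) (A u) x ⟩
      α * (D⁺ ∙ x) u + (1# - α) * (A ∙ x) u                  ≈⟨ +-congʳ (*-congˡ (sum-diagonal (outdegree u · 1#) x u)) ⟩
      α * (outdegree u · 1# * x u) + (1# - α) * (A ∙ x) u    ≈⟨ +-congʳ (*-congˡ (*-congʳ (outdegree≈degree u))) ⟩
      α * (degree u * x u) + (1# - α) * (A ∙ x) u            ≈⟨ +-congʳ (*-assoc _ _ _) ⟨
      α * degree u * x u + (1# - α) * (A ∙ x) u              ∎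

    module _ {α} (0≤α : 0# ≤ α) (α≤1 : α ≤ 1#) where

      Aα-nonNegative : ∀ u → NonNegative (Aα α u)
      Aα-nonNegative u w = +-nonNegative (*-nonNegative 0≤α (D⁺-nonNegative u w))
                                         (*-nonNegative (x≤y⇒0≤y-x α≤1) (A-nonNegative u w))
        where
        D⁺-nonNegative : ∀ u w → 0# ≤ D⁺ u w
        D⁺-nonNegative u w with does (u Fin.≟ w)
        ... | true  = ≤-trans (sum-nonNegative (A-nonNegative u)) (≤-reflexive (sym (outdegree≈degree u)))
        ... | false = ≤-refl

      -- The unit vector at u is subinvariant for α times the degree of u, because the adjacency
      -- part only adds nonnegative terms.
      α*degree≤ρ : ∀ {ρ} → IsSpectralRadius (Aα α) ρ → ∀ u → α * degree u ≤ ρ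
      α*degree≤ρ isρ u = collatz-wielandt Aα-nonNegative (0≤e , e≉0 , sub) isρ
        where
        e : Vector Carrier n
        e w = if does (u Fin.≟ w) then 1# else 0#
        0≤e : NonNegative e
        0≤e w with does (u Fin.≟ w)
        ... | true  = 0≤1
        ... | false = ≤-refl
        e≉0 : NonZero e
        e≉0 e≈0 with e≈0 u
        ... | eᵤ≈0 rewrite dec-true (u Fin.≟ u) ≡.refl = 0≉1 (sym eᵤ≈0)
        support : ∀ w → α * degree u * e w ≈ α * degree w * e w
        support w with u Fin.≟ w
        ... | yes ≡.refl = refl
        ... | no  _      = trans (zeroʳ _) (sym (zeroʳ _))
        sub : ∀ w → α * degree u * e w ≤ (Aα α ∙ e) w
        sub w = begin
          α * degree u * e w                           ≈⟨ support w ⟩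
          α * degree w * e w                           ≈⟨ +-identityʳ _ ⟨
          α * degree w * e w + 0#                      ≤⟨ +-mono-≤ ≤-refl (*-nonNegative (x≤y⇒0≤y-x α≤1) (∙-nonNegative A-nonNegative 0≤e w)) ⟩
          α * degree w * e w + (1# - α) * (A ∙ e) w    ≈⟨ Aα-∙ α e w ⟨
          (Aα α ∙ e) w                                 ∎

-- Comparison of G with G′.

module Comparison (ℝ : CompleteOrderedField) {n m : ℕ} (G : 𝒢 n m) where
  open CompleteOrderedField ℝ hiding (zero)
  open OrderedField ℝ
  open PerronFrobenius ℝ
  open Modulus ℝ
  open AlphaMatrix ℝ
  open Spectrum ℝ
  open DigraphMatrices ℝ
  open PartialOrderReasoning poset
  open 𝒢 G
  open Inverse vertices using (to; from; strictlyInverseˡ; strictlyInverseʳ)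

  private
    module H  = Digraph digraph
    module H′ = Digraph starDigraph
    module T i = Digraph (T i)

    V : Set
    V = Σ (Fin m) (Fin ∘ size)

    Arc Arc′ : V → V → Set
    Arc  = HangArc G* T root
    Arc′ = HangArc G* (λ i → outStar (root i)) root

  rootOf : Fin m → V
  rootOf i = i , root i

  -- The equation with a variable `v` lets `to (from p)` be replaced by `p` through matching.
  Arc-from : ∀ {u v w} → to u ≡ v → u H.⟶ w → Arc v (to w)
  Arc-from ≡.refl e = e

  Arc′-from : ∀ {u v w} → to u ≡ v → Arc′ v (to w) → u H′.⟶ w
  Arc′-from ≡.refl e = e

  -- Arcs of G* start at roots, so only tree arcs remain.
  nonRootArc : ∀ {i a q} → a ≢ root i → Arc (i , a) q → ∃[ b ] q ≡ (i , b) × T._⟶_ i a b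
  nonRootArc a≢root (core _) = contradiction ≡.refl a≢root
  nonRootArc a≢root (tree e) = _ , ≡.refl , e

  -- A core arc already leaves v_i, and a tree arc ends at a vertex of the same tree other than v_i,
  -- that is, at a leaf of the star.
  arc⇒starArc : ∀ {i a q} → q ≢ rootOf i → Arc (i , a) q → Arc′ (rootOf i) q
  arc⇒starArc q≢root (core e) = core e
  arc⇒starArc q≢root (tree e) = tree (≡.refl , λ { ≡.refl → q≢root ≡.refl })

  -- Exchanging (i , a) with v_i maps the out-neighbours of (i , a) in G to
  -- out-neighbours of v_i in G′.
  degree≤ : ∀ i a → degree digraph (from (i , a)) ≤ degree starDigraph (from (rootOf i))
  degree≤ i a = begin
    sum (A digraph u)                                      ≤⟨ sum-mono-≤ termwise ⟩
    sum (λ w → A starDigraph v (PC.transpose u v w))       ≈⟨ sum-permute (A starDigraph v) (transpose u v) ⟨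
    sum (A starDigraph v)                                  ∎
    where
    u = from (i , a)
    v = from (rootOf i)

    exchange : ∀ {w} → u H.⟶ w → v H′.⟶ PC.transpose u v w
    exchange {w} u⟶w = transpose-elim (v H′.⟶_) {u} {v}
      (λ w≡u → H.loopless (≡.sym w≡u) u⟶w)
      -- If u points to v_i, the transposition returns u itself; it is a leaf of the star, as a =
      -- root i would make the arc a loop.
      (λ w≡v → Arc′-from (strictlyInverseˡ (rootOf i))
        (≡.subst (Arc′ (rootOf i)) (≡.sym (strictlyInverseˡ (i , a)))
          (tree (≡.refl , λ a≡root → H.loopless (≡.trans (≡.cong (λ b → from (i , b)) a≡root) (≡.sym w≡v)) u⟶w))))
      (λ w≢v → Arc′-from (strictlyInverseˡ (rootOf i))
        (arc⇒starArc (λ to-w≡root → w≢v (≡.trans (≡.sym (strictlyInverseʳ w)) (≡.cong from to-w≡root)))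
                     (Arc-from (strictlyInverseˡ (i , a)) u⟶w)))

    termwise : ∀ w → A digraph u w ≤ A starDigraph v (PC.transpose u v w)
    termwise w = begin
      A digraph u w         ≈⟨ *-identityʳ _ ⟨
      A digraph u w * 1#    ≤⟨ A*-≤ digraph (A-nonNegative starDigraph v _)
                                 (λ u⟶w → ≤-reflexive (sym (A-arc starDigraph (exchange u⟶w)))) ⟩
      A starDigraph v _     ∎

  module _ {α} (0≤α : 0# ≤ α) (α≤1 : α ≤ 1#) {ρ ρ′} (ρ′<ρ : ρ′ < ρ)
           (isρ′ : IsSpectralRadius (Aα starDigraph α) ρ′)
           {x} (ρ-sub : IsSubinvariant (Aα digraph α) ρ x) where

    private
      0≤x = proj₁ ρ-sub
      0≤1-α = x≤y⇒0≤y-x α≤1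

      X : V → Carrier
      X = x ∘ from

      Support : ∀ i → Fin (size i) → Set
      Support i a = ¬ X (i , a) ≈ 0#

      support? : ∀ i → Decidable (Support i)
      support? i a = ¬? (X (i , a) ≟ 0#)

      ρx≤ : ∀ u → ρ * x u ≤ α * degree digraph u * x u + (1# - α) * (A digraph ∙ x) u
      ρx≤ u = ≤-trans (proj₂ (proj₂ ρ-sub) u) (≤-reflexive (Aα-∙ digraph α x u))

    -- Otherwise row (i , a) would give ρ ≤ α d⁺(i , a), hence ρ ≤ ρ′.
    nonRoot-successor : ∀ i {a} → a ≢ root i → Support i a → ∃[ b ] T._⟶_ i a b × Support i b
    nonRoot-successor i {a} a≢root xₐ≉0 with any? (λ b → T._⟶?_ i a b ×-dec support? i b)
    ... | yes found = found
    ... | no  none  = contradiction ρ≤ρ′ (<⇒≱ ρ′<ρ)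
      where
      u = from (i , a)

      zero-neighbour : ∀ w → u H.⟶ w → x w ≤ 0#
      zero-neighbour w u⟶w with nonRootArc a≢root (Arc-from (strictlyInverseˡ _) u⟶w)
      ... | b , to-w≡ , a⟶b = ≤-reflexive (begin-equality
        x w          ≡⟨ ≡.cong x (strictlyInverseʳ w) ⟨
        X (to w)     ≡⟨ ≡.cong X to-w≡ ⟩
        X (i , b)    ≈⟨ decidable-stable (X (i , b) ≟ 0#) (λ x_b≉0 → none (b , a⟶b , x_b≉0)) ⟩
        0#           ∎)

      ρ≤ρ′ : ρ ≤ ρ′
      ρ≤ρ′ = begin
        ρ                                        ≤⟨ *-cancelʳ-≤ (0≤x u , xₐ≉0 ∘ sym) row ⟩
        α * degree digraph u                     ≤⟨ *-monoʳ-≤ 0≤α (degree≤ i a) ⟩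
        α * degree starDigraph (from (rootOf i)) ≤⟨ α*degree≤ρ starDigraph 0≤α α≤1 isρ′ _ ⟩
        ρ′                                       ∎
        where
        row : ρ * x u ≤ α * degree digraph u * x u
        row = begin
          ρ * x u                                                       ≤⟨ ρx≤ u ⟩
          α * degree digraph u * x u + (1# - α) * (A digraph ∙ x) u     ≤⟨ +-mono-≤ ≤-refl (*-monoʳ-≤ 0≤1-α (sum-mono-≤ λ w → A*-≤ digraph ≤-refl (zero-neighbour w))) ⟩
          α * degree digraph u * x u + (1# - α) * sum {n} (λ _ → 0#)    ≈⟨ +-congˡ (trans (*-congˡ (sum-zero {n} λ _ → refl)) (zeroʳ _)) ⟩
          α * degree digraph u * x u + 0#                               ≈⟨ +-identityʳ _ ⟩
          α * degree digraph u * x u                                    ∎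

    private
      -- Non-root vertices of the support have tree successors in it, but a root may lead only into
      -- G*. Once the root is covered by the hypothesis, the support in this tree is
      -- successor-closed, hence empty.
      noSupport : ∀ i → (Support i (root i) → ∃[ b ] T._⟶_ i (root i) b × Support i b) → ∀ a → ¬ Support i a
      noSupport i root-successor = successorClosed⇒empty (T i) asymmetric acyclic successor
        where
        open Digraph.IsDirectedTree (isDirectedTree i)
        successor : ∀ {a} → Support i a → ∃[ b ] T._⟶_ i a b × Support i b
        successor {a} xₐ≉0 with a Fin.≟ root i
        ... | yes ≡.refl = root-successor xₐ≉0
        ... | no  a≢root = nonRoot-successor i a≢root xₐ≉0

    -- A supported tree out-neighbour could itself serve as the successor of the root, and the
    -- support would then be empty.
    treeNeighbour≈0 : ∀ i {b} → T._⟶_ i (root i) b → X (i , b) ≈ 0#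
    treeNeighbour≈0 i {b} root⟶b = decidable-stable (X (i , b) ≟ 0#)
      λ x_b≉0 → noSupport i (λ _ → b , root⟶b , x_b≉0) b x_b≉0

    -- If x vanished at every root, the root hypothesis of `noSupport` would hold vacuously and x
    -- would be 0.
    roots≉0 : ¬ (∀ i → X (rootOf i) ≈ 0#)
    roots≉0 roots≈0 = proj₁ (proj₂ ρ-sub) λ w → trans (reflexive (≡.cong x (≡.sym (strictlyInverseʳ w))))
      (decidable-stable (X (to w) ≟ 0#) (noSupport _ (λ xᵣ≉0 → contradiction (roots≈0 _) xᵣ≉0) _))

    private
      root? : (v : V) → Dec (proj₂ v ≡ root (proj₁ v))
      root? (i , a) = a Fin.≟ root i

      Y : V → Carrier
      Y v = if does (root? v) then X v else 0#

      y : Vector Carrier n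
      y = Y ∘ to

      0≤Y : ∀ v → 0# ≤ Y v
      0≤Y v with does (root? v)
      ... | true  = 0≤x (from v)
      ... | false = ≤-refl

      Y-root : ∀ i → Y (rootOf i) ≡ X (rootOf i)
      Y-root i rewrite dec-true (root i Fin.≟ root i) ≡.refl = ≡.refl

      y-root : ∀ i → y (from (rootOf i)) ≡ X (rootOf i)
      y-root i = ≡.trans (≡.cong Y (strictlyInverseˡ (rootOf i))) (Y-root i)

      -- The diagonal term does not decrease, by `degree≤`. In the adjacency sum core neighbours
      -- keep their entries, while tree neighbours contributed 0 already.
      root-row : ∀ i → ρ * X (rootOf i) ≤ (Aα starDigraph α ∙ y) (from (rootOf i))
      root-row i = begin
        ρ * x u                                                               ≤⟨ ρx≤ u ⟩
        α * degree digraph u * x u + (1# - α) * (A digraph ∙ x) u             ≤⟨ +-mono-≤ (*-monoˡ-≤ (0≤x u) (*-monoʳ-≤ 0≤α (degree≤ i (root i))))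
                                                                                          (*-monoʳ-≤ 0≤1-α (sum-mono-≤ λ w → A*-≤ digraph (*-nonNegative (A-nonNegative starDigraph u w) (0≤Y (to w))) (neighbour w))) ⟩
        α * degree starDigraph u * x u + (1# - α) * (A starDigraph ∙ y) u     ≡⟨ ≡.cong (λ t → α * degree starDigraph u * t + (1# - α) * (A starDigraph ∙ y) u) (y-root i) ⟨
        α * degree starDigraph u * y u + (1# - α) * (A starDigraph ∙ y) u     ≈⟨ Aα-∙ starDigraph α y u ⟨
        (Aα starDigraph α ∙ y) u                                              ∎
        where
        u = from (rootOf i)

        bound : ∀ {w q} → to w ≡ q → Arc (rootOf i) q → X q ≤ A starDigraph u w * Y q
        bound {w} to-w≡ (core {j = j} e) = begin
          X (rootOf j)                           ≡⟨ Y-root j ⟨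
          Y (rootOf j)                           ≈⟨ *-identityˡ _ ⟨
          1# * Y (rootOf j)                      ≈⟨ *-congʳ (A-arc starDigraph (Arc′-from (strictlyInverseˡ _) (≡.subst (Arc′ (rootOf i)) (≡.sym to-w≡) (core e)))) ⟨
          A starDigraph u w * Y (rootOf j)       ∎
        bound {w} {q} _ (tree e) = ≤-trans (≤-reflexive (treeNeighbour≈0 i e))
          (*-nonNegative (A-nonNegative starDigraph u w) (0≤Y q))

        neighbour : ∀ w → u H.⟶ w → x w ≤ A starDigraph u w * y w
        neighbour w u⟶w = ≤-trans (≤-reflexive (reflexive (≡.cong x (≡.sym (strictlyInverseʳ w)))))
          (bound ≡.refl (Arc-from (strictlyInverseˡ _) u⟶w))

      row : ∀ v → ρ * Y v ≤ (Aα starDigraph α ∙ y) (from v)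
      row (i , a) with a Fin.≟ root i
      ... | yes ≡.refl = root-row i
      -- The entry of `Y` is 0 here, so the inequality reduces to nonnegativity of the right side.
      ... | no  _      = ≤-trans (≤-reflexive (zeroʳ ρ))
                           (∙-nonNegative (Aα-nonNegative starDigraph 0≤α α≤1) (0≤Y ∘ to) (from (i , a)))

    restriction-subinvariant : IsSubinvariant (Aα starDigraph α) ρ y
    restriction-subinvariant =
      0≤Y ∘ to ,
      (λ y≈0 → roots≉0 λ i → trans (reflexive (≡.sym (y-root i))) (y≈0 (from (rootOf i)))) ,
      λ w → ≤-trans (row (to w)) (≤-reflexive (reflexive (≡.cong (Aα starDigraph α ∙ y) (strictlyInverseʳ w))))

theorem2p7 : (ℝ : CompleteOrderedField) →
    let open CompleteOrderedField ℝ
        open Spectrum ℝ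
        open DigraphMatrices ℝ
    in (n m : ℕ) (G : 𝒢 n m) (α : Carrier) → 0# ≤ α → α < 1# →
       (ρ ρ′ : Carrier) →
       IsSpectralRadius (Aα (𝒢.digraph G) α) ρ →
       IsSpectralRadius (Aα (𝒢.starDigraph G) α) ρ′ →
       ρ ≤ ρ′
theorem2p7 ℝ n m G α 0≤α (α≤1 , _) ρ ρ′ ((μ , μ-eig , ∣μ∣≈ρ) , _) isρ′@((_ , _ , 0≤ρ′ , _) , _) =
  decidable-stable (ρ ≤? ρ′) λ ρ≰ρ′ →
    let ρ′<ρ    = ≰⇒> ρ≰ρ′
        -- ρ′ is a modulus, hence nonnegative; ρ is therefore positive and can be inverted in the
        -- modulus estimate.
        0<ρ     = ≰⇒> (λ ρ≤0 → ρ≰ρ′ (≤-trans ρ≤0 0≤ρ′))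
        _ , ρ-sub = eigenvalue⇒subinvariant (Aα-nonNegative (𝒢.digraph G) 0≤α α≤1) μ-eig ∣μ∣≈ρ 0<ρ
    in ρ≰ρ′ (collatz-wielandt (Aα-nonNegative (𝒢.starDigraph G) 0≤α α≤1)
               (restriction-subinvariant 0≤α α≤1 ρ′<ρ isρ′ ρ-sub) isρ′)
  where
  open CompleteOrderedField ℝ
  open OrderedField ℝ
  open PerronFrobenius ℝ
  open Modulus ℝ
  open AlphaMatrix ℝ
  open Comparison ℝ G
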